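{- Let $\lambda\in P$, $\lhd\in\mathrm{RO}(\lambda,\Delta^+)$ and $w\in W$. Then the image of the forgetful map $\tilde\Xi:\mathcal{A}(w,\Gamma)\to\mathrm{IQLS}(\lambda)\times W$ is $$\operatorname{im}(\tilde\Xi)=\Bigl\{(\eta,u)\in\mathrm{IQLS}(\lambda)\times W\ \Bigm|\ w\overset{(\lambda,+)}{\Longrightarrow}\kappa(\eta)\ \text{and}\ \iota(\eta)\overset{(\lambda,-)}{\Longrightarrow}u\Bigr\}.$$
   Context: Let $\mathfrak{g}$ be a finite-dimensional complex simple Lie algebra with root system $\Delta$, positive roots $\Delta^+$, Weyl group $W$ with length function $\ell$ and reflections $s_\alpha$, weight lattice $P$, pairing $\langle\cdot,\cdot\rangle$, $\alpha^\vee$ the coroot of $\alpha$, $\rho=\frac12\sum_{\alpha\in\Delta^+}\alpha$. For $\alpha\in\Delta$, $\operatorname{sgn}(\alpha)=\pm1$ according as $\alpha\in\pm\Delta^+$, and $|\alpha|=\operatorname{sgn}(\alpha)\alpha$. For $\lambda\in P$, $\Delta^+(\lambda)_{>0}$, $\Delta^+(\lambda)_{=0}$, $\Delta^+(\lambda)_{<0}$ are the sets of $\alpha\in\Delta^+$ with $\langle\lambda,\alpha^\vee\rangle>0$, $=0$, $<0$. Quantum Bruhat graph $\mathrm{QBG}(W)$: vertices $W$; an edge $x\xrightarrow{\alpha}y$ ($\alpha\in\Delta^+$) whenever $y=xs_\alpha$ and either $\ell(y)=\ell(x)+1$ (Bruhat edge) or $\ell(y)=\ell(x)-2\langle\rho,\alpha^\vee\rangle+1$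 (quantum edge). Reflection orders: a total order $\lhd$ on $\Delta^+$ is a reflection order if whenever $\alpha,\beta,\alpha+\beta\in\Delta^+$, either $\alpha\lhd\alpha+\beta\lhd\beta$ or $\beta\lhd\alpha+\beta\lhd\alpha$; $\mathrm{RO}(\lambda,\Delta^+)$ is the set of those with $\alpha\lhd\beta\lhd\gamma$ for $\alpha\in\Delta^+(\lambda)_{<0}$, $\beta\in\Delta^+(\lambda)_{=0}$, $\gamma\in\Delta^+(\lambda)_{>0}$. Fix such $\lhd$. Interpolated QLS paths: for $x,y\in W$, $\sigma\in\mathbb{Q}$, write $x\overset{(\lambda,+)}{\Longrightarrow}_\sigma y$ if there is a directed path $x=x_0\xrightarrow{\gamma_1}x_1\to\cdots\xrightarrow{\gamma_r}x_r=y$ in $\mathrm{QBG}(W)$ ($r\ge0$) with all $\gamma_k\in\Delta^+(\lambda)_{>0}$, $\gamma_{k+1}\lhd\gamma_k$ for all $k$, and $\sigma\langle\lambda,\gamma_k^\vee\rangle\in\mathbb{Z}$ for all $k$; $x\overset{(\lambda,-)}{\Longrightarrow}_\sigma y$ is defined identically with $\Delta^+(\lambda)_{<0}$ in place of $\Delta^+(\lambda)_{>0}$. When $\sigma=1$ the subscript is omitted. An interpolated QLS path of shape $\lambda$ is a triple $\eta=(x_1,\dots,x_s;y_1,\dots,y_{s-1};\sigma_0,\dots,\sigma_s)$ ($s\ge1$) with $x_i,y_i\in W$, $x_i\ne x_{i+1}$, $y_i\ne y_{i+1}$, $\sigma_i\in\mathbb{Q}$, $0=\sigma_0<\sigma_1<\dots<\sigma_s=1$,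 and for $1\le i\le s-1$: $x_{i+1}\overset{(\lambda,-)}{\Longrightarrow}_{\sigma_i}y_i$ and $y_i\overset{(\lambda,+)}{\Longrightarrow}_{\sigma_i}x_i$. $\mathrm{IQLS}(\lambda)$ is the set of these; $\iota(\eta):=x_1$ (initial direction), $\kappa(\eta):=x_s$ (final direction). Affine data: real affine coroots $\gamma^\vee+k\tilde\delta$ ($\gamma\in\Delta$, $k\in\mathbb{Z}$, $\tilde\delta$ formal); for $\beta^\vee=\gamma^\vee+k\tilde\delta$ put $\overline{\beta^\vee}=\gamma^\vee$, $\overline\beta=\gamma$, $\deg(\beta^\vee)=k$; it is positive if $k>0$ or ($k=0$, $\gamma\in\Delta^+$), negative otherwise; $t_\lambda(\gamma^\vee+k\tilde\delta)=\gamma^\vee+(k-\langle\lambda,\gamma^\vee\rangle)\tilde\delta$; $\mathrm{Inv}(\lambda)$ is the set of positive real affine coroots $\beta^\vee$ with $t_\lambda(\beta^\vee)$ negative (for these, $\langle\lambda,\overline{\beta^\vee}\rangle>0$ and $\overline\beta\in\Delta^+(\lambda)_{>0}\sqcup(-\Delta^+(\lambda)_{<0})$); put $d(\beta^\vee)=\deg(\beta^\vee)/\langle\lambda,\overline{\beta^\vee}\rangle$. Order $\prec$ on $\Delta^+(\lambda)_{>0}\sqcup(-\Delta^+(\lambda)_{<0})$: elements of $\Delta^+(\lambda)_{>0}$ precede those of $-\Delta^+(\lambda)_{<0}$; $\gamma\prec\gamma'$ iff $\gamma\lhd\gamma'$ on $\Delta^+(\lambda)_{>0}$; $-\alpha\prec-\alpha'$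 iff $\alpha\lhd\alpha'$ on $-\Delta^+(\lambda)_{<0}$. Order $<$ on $\mathrm{Inv}(\lambda)$: $\beta^\vee<\beta'^\vee$ iff $d(\beta^\vee)<d(\beta'^\vee)$, or they are equal and $\overline{\beta'}\prec\overline\beta$. Write $\mathrm{Inv}(\lambda)=\{\beta_1^\vee<\dots<\beta_r^\vee\}$, $\gamma_k:=\overline{\beta_k}$, $d_k:=d(\beta_k^\vee)$, and $\Gamma:=(\gamma_1,\dots,\gamma_r)$ (the suitable $\lambda$-chain for $\lhd$). Admissible subsets: for $w\in W$, $\mathcal{A}(w,\Gamma)$ is the set of $A=\{j_1<\dots<j_p\}\subseteq\{1,\dots,r\}$ such that $w=u_0\xrightarrow{|\gamma_{j_1}|}u_1\to\cdots\xrightarrow{|\gamma_{j_p}|}u_p$ is a directed path in $\mathrm{QBG}(W)$, where $u_a:=ws_{|\gamma_{j_1}|}\cdots s_{|\gamma_{j_a}|}$; $\mathrm{end}(A):=u_p$. One has $0\le d_{j_1}\le\dots\le d_{j_p}\le1$. The map $\Xi$: let $0<c_1<\dots<c_{t-1}<1$ ($t\ge1$) be the distinct values among $d_{j_1},\dots,d_{j_p}$ lying strictly between $0$ and $1$; put $c_0:=0$, $c_t:=1$. For $1\le a\le t$ let $m_a:=\#\{b\mid d_{j_b}<c_a\}$; for $1\le a\le t-1$ let $n_a:=m_a+\#\{b\mid m_a<b\le m_{a+1},\ \gamma_{j_b}\in-\Delta^+\}$. Then $\Xi(A):=(x_1,\dots,x_t;y_1,\dots,y_{t-1};\sigma_0,\dots,\sigma_t)$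 with $x_i:=u_{m_{t+1-i}}$, $y_i:=u_{n_{t-i}}$, $\sigma_i:=1-c_{t-i}$; this lies in $\mathrm{IQLS}(\lambda)$. The forgetful map is $\tilde\Xi(A):=(\Xi(A),\mathrm{end}(A))\in\mathrm{IQLS}(\lambda)\times W$.
   Formalization: Ξ(A) can violate y_i ≠ y_{i+1} (type A₂, λ = −3ω₁+3ω₂, A = {2,5}), so Ξ(A) ∈ IQLS(λ) is not asserted; the equality is proved within IQLS(λ)×W, and the two end conditions are proved for every admissible A. -}

module Defs where

open import Level using (0ℓ)
open import Data.Bool.Base using (Bool; true; false)
open import Data.Nat.Base as ℕ using (ℕ; suc)
open import Data.Integer.Base as ℤ using (ℤ; +_; -[1+_]; +[1+_]; 0ℤ; 1ℤ)
open import Data.Rational.Base as ℚ using (ℚ; 0ℚ; 1ℚ; _/_)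
import Data.Rational.Properties as ℚ
open import Data.Sign.Base as Sign using (Sign)
open import Data.Fin.Base using (Fin; suc; inject₁)
open import Data.Fin.Subset using (Subset)
open import Data.Vec.Base as Vec using (Vec; []; _∷_; lookup; tabulate; _[_]≔_)
open import Data.Vec.Membership.Propositional using (_∈_)
open import Data.Vec.Relation.Unary.Linked using () renaming (Linked to Linkedᵛ)
open import Data.List.Base as List using (List; []; _∷_; length)
open import Data.List.Relation.Unary.All using (All)
open import Data.List.Relation.Unary.Linked using (Linked)
open import Data.Product.Base using (Σ-syntax; ∃-syntax; _×_; _,_; proj₁; proj₂)
open import Data.Sum.Base using (_⊎_)
open import Data.Empty using (⊥)
open import Data.Unit.Base using (⊤)
open import Function.Base using (_∘_)
open import Function.Bundles using (_⇔_)
open import Relation.Nullary using (¬_; Dec; yes; no; ¬?)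
open import Relation.Nullary.Decidable using (_×-dec_)
open import Relation.Unary using (Pred)
open import Relation.Binary.Core using (Rel)
open import Relation.Binary.Structures using (IsStrictTotalOrder)
open import Relation.Binary.PropositionalEquality.Core using (_≡_; _≢_; refl)

infixl 6 _⊕_ _⊖_
infixl 7 _⊙_

_⊕_ _⊖_ : ∀ {n} → Vec ℤ n → Vec ℤ n → Vec ℤ n
_⊕_ = Vec.zipWith ℤ._+_
_⊖_ = Vec.zipWith ℤ._-_

_⊙_ : ∀ {n} → ℤ → Vec ℤ n → Vec ℤ n
k ⊙ v = Vec.map (k ℤ.*_) v

∑ : ∀ {m n} → (Fin m → Vec ℤ n) → Vec ℤ n
∑ {n = n} f = Vec.foldr′ _⊕_ (Vec.replicate n 0ℤ) (tabulate f)

basis : ∀ {n} → Fin n → Vec ℤ n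
basis {n} i = Vec.replicate n 0ℤ [ i ]≔ 1ℤ

⟨_,_⟩ : ∀ {n} → Vec ℤ n → Vec ℤ n → ℤ
⟨ v , f ⟩ = Vec.foldr′ ℤ._+_ 0ℤ (Vec.zipWith ℤ._*_ v f)

applySign : ∀ {n} → Sign → Vec ℤ n → Vec ℤ n
applySign Sign.+ v = v
applySign Sign.- v = Vec.map ℤ.-_ v

-- An irreducible reduced crystallographic root system with a chosen positive
-- system, i.e. the root datum of a simple complex Lie algebra.
--
-- The weight lattice P is ℤ^rank with the fundamental weights as standard
-- basis, and the coroot lattice is ℤ^rank with the simple coroots as standard
-- basis; the pairing between the two is therefore the dot product.
-- The set Δ of roots is Sign × Fin numPos: (+ , a) is the a-th positive root
-- and (- , a) its negative.
record RootSystem : Set where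
  field
    rank numPos      : ℕ
    {{rank-nonZero}} : ℕ.NonZero rank
    root⁺            : Fin numPos → Vec ℤ rank
    coroot⁺          : Fin numPos → Vec ℤ rank

  Δ⁺ : Set
  Δ⁺ = Fin numPos

  Δ : Set
  Δ = Sign × Δ⁺

  P : Set
  P = Vec ℤ rank

  root : Δ → Vec ℤ rank
  root (s , a) = applySign s (root⁺ a)

  coroot : Δ → Vec ℤ rank
  coroot (s , a) = applySign s (coroot⁺ a)

  field
    root-coroot : ∀ a → ⟨ root⁺ a , coroot⁺ a ⟩ ≡ + 2

    reflection-closed : ∀ (α β : Δ) → ∃[ γ ]
      root γ ≡ root β ⊖ ⟨ root β , coroot α ⟩ ⊙ root α ×
      coroot γ ≡ coroot β ⊖ ⟨ root α , coroot β ⟩ ⊙ coroot α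

    -- The only rational multiples of a root that are roots are ± itself.
    reduced : ∀ (a b : Δ⁺) (p q : ℤ) → p ≢ 0ℤ →
      p ⊙ root⁺ a ≡ q ⊙ root⁺ b → a ≡ b

    simple : Fin rank → Δ⁺

    simple-coroot : ∀ i → coroot⁺ (simple i) ≡ basis i

    positive : ∀ a → Σ[ c ∈ (Fin rank → ℕ) ]
      root⁺ a ≡ ∑ (λ i → + c i ⊙ root⁺ (simple i))

    -- Δ is not the disjoint union of two nonempty, mutually orthogonal subsets.
    irreducible : ∀ (f : Δ → Bool) →
      (∀ α β → f α ≢ f β → ⟨ root α , coroot β ⟩ ≡ 0ℤ) →
      ∀ α β → f α ≡ f β

  ⟪_,_∨⟫ : P → Δ → ℤ
  ⟪ lam , γ ∨⟫ = ⟨ lam , coroot γ ⟩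

  ⟪_,_⁺∨⟫ : P → Δ⁺ → ℤ
  ⟪ lam , a ⁺∨⟫ = ⟨ lam , coroot⁺ a ⟩

  2ρ : P
  2ρ = ∑ root⁺

module WeylGroup (R : RootSystem) where
  open RootSystem R

  -- An endomorphism of P, given by the images of the fundamental weights.
  End : Set
  End = Vec P rank

  apply : End → P → P
  apply x v = ∑ (λ i → lookup v i ⊙ lookup x i)

  reflect : Δ⁺ → P → P
  reflect a v = v ⊖ ⟪ v , a ⁺∨⟫ ⊙ root⁺ a

  one : End
  one = tabulate basis

  infixl 7 _∙s_ _·s_

  -- The composite x ∘ s_α.
  _∙s_ : End → Δ⁺ → End
  x ∙s a = tabulate (λ i → apply x (reflect a (basis i)))

  product : List Δ⁺ → End
  product = List.foldl _∙s_ one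

  -- The group generated by the reflections.  The generation witness is
  -- irrelevant, so two elements are equal as soon as they are the same
  -- endomorphism of P.
  record W : Set where
    constructor mkW
    field
      endo       : End
      .generated : ∃[ αs ] endo ≡ product αs

  open W public

  private
    snoc : ∀ x αs a → x ≡ product αs → x ∙s a ≡ product (αs List.∷ʳ a)
    snoc x αs a refl = go one αs
      where
      go : ∀ e bs → List.foldl _∙s_ e bs ∙s a ≡ List.foldl _∙s_ e (bs List.∷ʳ a)
      go e []       = refl
      go e (b ∷ bs) = go (e ∙s b) bs

  _·s_ : W → Δ⁺ → W
  mkW x g ·s a = mkW (x ∙s a) (proj₁ g List.∷ʳ a , snoc x (proj₁ g) a (proj₂ g))

  _IsProductOf_ : W → List (Fin rank) → Set
  x IsProductOf is = endo x ≡ product (List.map simple is)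

  -- HasLength x k means ℓ(x) = k.
  HasLength : W → ℕ → Set
  HasLength x k =
    (∃[ is ] x IsProductOf is × length is ≡ k) ×
    (∀ is → x IsProductOf is → k ℕ.≤ length is)

  -- Edge x a y : there is an edge x → y with label a in the quantum Bruhat graph.
  Edge : W → Δ⁺ → W → Set
  Edge x a y = y ≡ x ·s a × ∃[ k ] ∃[ l ] HasLength x k × HasLength y l ×
    (l ≡ k ℕ.+ 1 ⊎ + l ≡ + k ℤ.- ⟪ 2ρ , a ⁺∨⟫ ℤ.+ 1ℤ)

  -- Path x as y : there is a directed path from x to y with label sequence as.
  data Path (x : W) : List Δ⁺ → W → Set where
    []  : Path x [] x
    _∷_ : ∀ {a z as y} → Edge x a z → Path z as y → Path x (a ∷ as) y

IsIntegral : ℚ → Set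
IsIntegral q = ∃[ k ] q ≡ k / 1

module Shape (R : RootSystem)
             (lam : RootSystem.P R)
             (_◁_ : Rel (RootSystem.Δ⁺ R) 0ℓ) where
  open RootSystem R
  open WeylGroup R

  Δ⁺>0 Δ⁺=0 Δ⁺<0 : Δ⁺ → Set
  Δ⁺>0 a = 0ℤ ℤ.< ⟪ lam , a ⁺∨⟫
  Δ⁺=0 a = ⟪ lam , a ⁺∨⟫ ≡ 0ℤ
  Δ⁺<0 a = ⟪ lam , a ⁺∨⟫ ℤ.< 0ℤ

  -- The order ◁ belongs to RO(λ, Δ⁺).  The last condition says that the block
  -- Δ⁺(λ)_{<0} precedes Δ⁺(λ)_{>0} also when Δ⁺(λ)_{=0} is empty.
  record IsRO : Set where
    field
      isStrictTotalOrder : IsStrictTotalOrder _≡_ _◁_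
      convex : ∀ a b c → root⁺ c ≡ root⁺ a ⊕ root⁺ b →
        (a ◁ c × c ◁ b) ⊎ (b ◁ c × c ◁ a)
      <0◁=0 : ∀ {a b} → Δ⁺<0 a → Δ⁺=0 b → a ◁ b
      =0◁>0 : ∀ {a b} → Δ⁺=0 a → Δ⁺>0 b → a ◁ b
      <0◁>0 : ∀ {a b} → Δ⁺<0 a → Δ⁺>0 b → a ◁ b

  Block : Sign → Δ⁺ → Set
  Block Sign.+ = Δ⁺>0
  Block Sign.- = Δ⁺<0

  infix 4 _⟹[_∣_]_ _⟹[_]_

  _⟹[_∣_]_ : W → Sign → ℚ → W → Set
  x ⟹[ s ∣ σ ] y = ∃[ γs ]
    Path x γs y ×
    All (Block s) γs ×
    Linked (λ γ γ′ → γ′ ◁ γ) γs ×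
    All (λ γ → IsIntegral (σ ℚ.* (⟪ lam , γ ⁺∨⟫ / 1))) γs

  _⟹[_]_ : W → Sign → W → Set
  x ⟹[ s ] y = x ⟹[ s ∣ 1ℚ ] y

  -- The sequences (x₁,…,x_s; y₁,…,y_{s-1}; σ₀,…,σ_s), with s = suc m.
  record Triple : Set where
    constructor triple
    field
      m : ℕ
      x : Vec W (suc m)
      y : Vec W m
      σ : Vec ℚ (suc (suc m))

  -- For i : Fin m, the conditions relating x_{k+1}, y_k, x_k and σ_k are
  -- those with k = suc (toℕ i); the vectors x and y are indexed from 1 in the
  -- mathematical notation and from 0 here, while σ is indexed from 0 in both.
  record IsIQLS (η : Triple) : Set where
    open Triple η
    field
      x-distinct : Linkedᵛ _≢_ x
      y-distinct : Linkedᵛ _≢_ y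
      σ-first    : Vec.head σ ≡ 0ℚ
      σ-last     : Vec.last σ ≡ 1ℚ
      σ-increase : Linkedᵛ ℚ._<_ σ
      x⟹y        : ∀ i →
        lookup x (suc i) ⟹[ Sign.- ∣ lookup σ (suc (inject₁ i)) ] lookup y i
      y⟹x        : ∀ i →
        lookup y i ⟹[ Sign.+ ∣ lookup σ (suc (inject₁ i)) ] lookup x (inject₁ i)

  ι κ : Triple → W
  ι η = Vec.head (Triple.x η)
  κ η = Vec.last (Triple.x η)

  -- The real affine coroot γ^∨ + k δ̃, recorded as the pair of γ and k.
  record AffineCoroot : Set where
    constructor _+_δ
    field
      bar : Δ
      deg : ℤ

  open AffineCoroot public

  IsPositive IsNegative : AffineCoroot → Set
  IsPositive ((s , a) + k δ) = 0ℤ ℤ.< k ⊎ (k ≡ 0ℤ × s ≡ Sign.+)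
  IsNegative β = ¬ IsPositive β

  t : AffineCoroot → AffineCoroot
  t (γ + k δ) = γ + (k ℤ.- ⟪ lam , γ ∨⟫) δ

  Inv : AffineCoroot → Set
  Inv β = IsPositive β × IsNegative (t β)

  -- deg(β^∨) / ⟨λ, β̄^∨⟩; the value 0 for a zero denominator is a convention,
  -- irrelevant on Inv(λ), where the denominator is positive.
  d : AffineCoroot → ℚ
  d (γ + k δ) with ⟪ lam , γ ∨⟫
  ... | +[1+ n ] = k / suc n
  ... | + 0      = 0ℚ
  ... | -[1+ n ] = ℤ.- k / suc n

  infix 4 _≺_ _<ᴵ_

  -- Only used on Δ⁺(λ)_{>0} ⊔ -Δ⁺(λ)_{<0}.
  _≺_ : Rel Δ 0ℓ
  (Sign.+ , a) ≺ (Sign.- , b) = ⊤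
  (Sign.- , a) ≺ (Sign.+ , b) = ⊥
  (Sign.+ , a) ≺ (Sign.+ , b) = a ◁ b
  (Sign.- , a) ≺ (Sign.- , b) = a ◁ b

  _<ᴵ_ : Rel AffineCoroot 0ℓ
  β <ᴵ β′ = d β ℚ.< d β′ ⊎ (d β ≡ d β′ × bar β′ ≺ bar β)

  -- The increasing enumeration β₁ < … < β_r of Inv(λ), which determines the
  -- suitable λ-chain Γ = (bar β₁, …, bar β_r).
  record SuitableChain : Set where
    field
      r          : ℕ
      βs         : Vec AffineCoroot r
      increasing : Linkedᵛ _<ᴵ_ βs
      enumerates : ∀ β → β ∈ βs ⇔ Inv β

  module Forgetful (Γ : SuitableChain) (w : W) where
    open SuitableChain Γ

    -- For A = {j₁ < … < j_p}, the list β_{j₁}, …, β_{j_p}.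
    select : ∀ {n} → Vec AffineCoroot n → Subset n → List AffineCoroot
    select []       []          = []
    select (β ∷ βs) (true ∷ A)  = β ∷ select βs A
    select (β ∷ βs) (false ∷ A) = select βs A

    chosen : Subset r → List AffineCoroot
    chosen = select βs

    -- The list |γ_{j₁}|, …, |γ_{j_p}|.
    labels : Subset r → List Δ⁺
    labels A = List.map (proj₂ ∘ bar) (chosen A)

    u : Subset r → ℕ → W
    u A a = List.foldl _·s_ w (List.take a (labels A))

    end : Subset r → W
    end A = u A (length (labels A))

    𝒜 : Pred (Subset r) 0ℓ
    𝒜 A = Path w (labels A) (end A)

    isNegativeRoot? : (β : AffineCoroot) → Dec (proj₁ (bar β) ≡ Sign.-)
    isNegativeRoot? ((Sign.- , a) + k δ) = yes refl
    isNegativeRoot? ((Sign.+ , a) + k δ) = no λ ()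

    module _ (A : Subset r) where

      -- c₁, …, c_{t-1}; they come out in increasing order because
      -- d_{j₁} ≤ … ≤ d_{j_p}.
      cs : List ℚ
      cs = List.deduplicate ℚ._≟_
             (List.filter (λ q → (0ℚ ℚ.<? q) ×-dec (q ℚ.<? 1ℚ))
               (List.map d (chosen A)))

      -- c₀, c₁, …, c_t
      c : Vec ℚ (suc (suc (length cs)))
      c = 0ℚ ∷ (Vec.fromList cs Vec.∷ʳ 1ℚ)

      -- m_a as a function of c_a
      mᶜ : ℚ → ℕ
      mᶜ q = length (List.filter (λ β → d β ℚ.<? q) (chosen A))

      -- n_a as a function of c_a and c_{a+1}
      nᶜ : ℚ → ℚ → ℕ
      nᶜ q q′ = mᶜ q ℕ.+ length (List.filter isNegativeRoot?
                  (List.drop (mᶜ q) (List.take (mᶜ q′) (chosen A))))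

      -- The index i of x_i, y_i and σ_i runs opposite to the index of c.
      -- The codomain is Triple rather than the subtype IsIQLS: y_i = y_{i+1}
      -- happens as soon as every γ_j at some c_a is a negative root and every
      -- γ_j at c_{a+1} is a positive one.
      Ξ : Triple
      Ξ = record
        { m = length cs
        ; x = Vec.reverse (Vec.map (u A ∘ mᶜ) (Vec.tail c))
        ; y = Vec.reverse (tabulate λ a →
                u A (nᶜ (lookup c (suc (inject₁ a))) (lookup c (suc (suc a)))))
        ; σ = Vec.reverse (Vec.map (λ q → 1ℚ ℚ.- q) c)
        }

    Ξ̃ : Subset r → Triple × W
    Ξ̃ A = Ξ A , end A

    -- The image of 𝒜(w, Γ) under Ξ̃.
    imΞ̃ : Pred (Triple × W) 0ℓ
    imΞ̃ p = ∃[ A ] 𝒜 A × Ξ̃ A ≡ p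

    EndConditions : Pred (Triple × W) 0ℓ
    EndConditions (η , v) = w ⟹[ Sign.+ ] κ η × ι η ⟹[ Sign.- ] v

{-# OPTIONS --safe #-}
module Submission where

-- An admissible subset is a list of affine coroots that is increasing for <ᴵ
-- and whose labels form a path from w.  Cutting the list where d changes value,
-- and each piece where the roots change sign, gives segments on which d and the
-- sign are constant; on such a segment <ᴵ is the reverse of ◁ on the labels, so
-- a segment with d = c and sign s amounts to a path witnessing ⟹[ s ∣ 1 - c ].
-- The segment with d = 0 consists of positive roots and
-- the one with d = 1 of negative roots: they are the two end conditions, while
-- the segments with 0 < d < 1 are the paths of an interpolated QLS path, in
-- reverse order.  Conversely the segments read off from a QLS path and its end
-- conditions concatenate to an increasing list in Inv(λ), hence to a subset of
-- the chain, and the condition x_i ≠ x_{i+1} says that no value of d is lost.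

open import Defs
open import Level using (Level; 0ℓ)
open import Algebra.Properties.Group using (⁻¹-involutive)
open import Data.Bool.Base using (true; false)
open import Data.Fin.Base as Fin using (inject₁)
open import Data.Fin.Subset using (Subset)
open import Data.Integer.Base as ℤ using (ℤ; +_; -[1+_]; +[1+_]; 0ℤ; 1ℤ)
import Data.Integer.Properties as ℤ
open import Data.List.Base as List
  using (List; []; _∷_; _++_; [_]; length; map; take; drop; filter; reverse; foldl; deduplicate; _ʳ++_)
import Data.List.Properties as List
open import Data.List.Membership.Propositional using () renaming (_∈_ to _∈ˡ_)
open import Data.List.Membership.Propositional.Properties using (∈-filter⁺; ∈-map⁺)
open import Data.List.Relation.Unary.All as All using (All; []; _∷_)
import Data.List.Relation.Unary.All.Properties as All
open import Data.List.Relation.Unary.AllPairs as AllPairs using (AllPairs; []; _∷_)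
import Data.List.Relation.Unary.AllPairs.Properties as AllPairs
open import Data.List.Relation.Unary.Any using (here; there)
import Data.List.Relation.Unary.Linked.Properties as Linked
import Data.Nat.Coprimality as Coprimality
open import Data.Nat.Base as ℕ using (ℕ; suc)
open import Data.Nat.Properties using (≤-refl)
open import Data.Product.Base using (∃-syntax; _×_; _,_; proj₁; proj₂)
open import Data.Rational.Base as ℚ using (ℚ; mkℚ; 0ℚ; 1ℚ; _/_; toℚᵘ; *≤*; *<*)
import Data.Rational.Properties as ℚ
import Data.Rational.Unnormalised.Base as ℚᵘ
import Data.Rational.Unnormalised.Properties as ℚᵘ
open import Data.Sign.Base as Sign using (Sign)
open import Data.Sum.Base using (inj₁; inj₂)
open import Data.Unit.Base using (tt)
open import Data.Vec.Base as Vec using (Vec; []; _∷_; lookup)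
open import Data.Vec.Membership.Propositional using (_∈_)
import Data.Vec.Properties as Vec
open import Data.Vec.Relation.Unary.Any using (here; there)
open import Data.Vec.Relation.Unary.Linked as Linkedᵛ using (_∷_) renaming (Linked to Linkedᵛ)
open import Function.Base using (_∘_; flip)
open import Function.Bundles using (Equivalence; _⇔_; mk⇔)
open import Relation.Binary.Core using (Rel)
open import Relation.Binary.Definitions using (Transitive; DecidableEquality)
open import Relation.Binary.PropositionalEquality hiding ([_])
open import Relation.Binary.Structures using (IsStrictTotalOrder)
open import Relation.Nullary using (¬_; yes; no; ¬?; contradiction)
open import Relation.Nullary.Decidable using (_×-dec_)
open import Relation.Unary using (Pred)

private
  variable
    a ℓ ℓ′ : Level
    A B : Set a

-- Arithmetic of the embedding of ℤ in ℚ, of 1 - q, and of the pairing.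

fromℤ : ℤ → ℚ
fromℤ i = i / 1

private
  -- The division `i / 1` normalises by a gcd and does not reduce for a variable `i`; once it is
  -- rewritten to a literal `mkℚ`, comparisons and sums of embedded integers compute.
  fromℤ-mkℚ : ∀ i → i / 1 ≡ mkℚ i 0 (Coprimality.sym (Coprimality.1-coprimeTo _))
  fromℤ-mkℚ i = ℚ.↥p/↧p≡p (mkℚ i 0 _)

fromℤ-mono-≤ : ∀ {i j} → i ℤ.≤ j → fromℤ i ℚ.≤ fromℤ j
fromℤ-mono-≤ {i} {j} i≤j rewrite fromℤ-mkℚ i | fromℤ-mkℚ j =
  *≤* (ℤ.*-monoʳ-≤-nonNeg 1ℤ i≤j)

fromℤ-mono-< : ∀ {i j} → i ℤ.< j → fromℤ i ℚ.< fromℤ j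
fromℤ-mono-< {i} {j} i<j rewrite fromℤ-mkℚ i | fromℤ-mkℚ j =
  *<* (ℤ.*-monoʳ-<-pos 1ℤ i<j)

fromℤ-cancel-≤ : ∀ {i j} → fromℤ i ℚ.≤ fromℤ j → i ℤ.≤ j
fromℤ-cancel-≤ le = ℤ.≮⇒≥ λ gt → ℚ.<-irrefl refl (ℚ.<-≤-trans (fromℤ-mono-< gt) le)

fromℤ-cancel-< : ∀ {i j} → fromℤ i ℚ.< fromℤ j → i ℤ.< j
fromℤ-cancel-< lt = ℤ.≰⇒> λ ge → ℚ.<-irrefl refl (ℚ.<-≤-trans lt (fromℤ-mono-≤ ge))

fromℤ-homo-neg : ∀ i → fromℤ (ℤ.- i) ≡ ℚ.- fromℤ i
fromℤ-homo-neg i rewrite fromℤ-mkℚ i = trans (fromℤ-mkℚ (ℤ.- i)) (lem i)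
  where
  lem : ∀ i → mkℚ (ℤ.- i) 0 (Coprimality.sym (Coprimality.1-coprimeTo _)) ≡
    ℚ.- mkℚ i 0 (Coprimality.sym (Coprimality.1-coprimeTo _))
  lem (+ 0)    = refl
  lem +[1+ n ] = refl
  lem -[1+ n ] = refl

fromℤ-homo-+ : ∀ i j → fromℤ (i ℤ.+ j) ≡ fromℤ i ℚ.+ fromℤ j
fromℤ-homo-+ i j rewrite fromℤ-mkℚ i | fromℤ-mkℚ j =
  cong (_/ 1) (sym (cong₂ ℤ._+_ (ℤ.*-identityʳ i) (ℤ.*-identityʳ j)))

-- Passing to unnormalised fractions makes multiplication componentwise, so that only an identity of
-- cross products in ℤ remains.
/-*-cancel : ∀ k n → (k / suc n) ℚ.* fromℤ +[1+ n ] ≡ fromℤ k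
/-*-cancel k n = ℚ.toℚᵘ-injective (begin
  toℚᵘ ((k / suc n) ℚ.* fromℤ +[1+ n ])
    ≈⟨ ℚ.toℚᵘ-homo-* (k / suc n) (fromℤ +[1+ n ]) ⟩
  toℚᵘ (k / suc n) ℚᵘ.* toℚᵘ (fromℤ +[1+ n ])
    ≈⟨ ℚᵘ.*-cong (ℚ.toℚᵘ-fromℚᵘ (ℚᵘ.mkℚᵘ k n)) (ℚ.toℚᵘ-fromℚᵘ (ℚᵘ.mkℚᵘ +[1+ n ] 0)) ⟩
  ℚᵘ.mkℚᵘ k n ℚᵘ.* ℚᵘ.mkℚᵘ +[1+ n ] 0
    ≈⟨ ℚᵘ.*≡* (trans (ℤ.*-assoc k +[1+ n ] 1ℤ) (cong (k ℤ.*_) (ℤ.pos-* (suc n) 1))) ⟩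
  ℚᵘ.mkℚᵘ k 0
    ≈⟨ ℚ.toℚᵘ-fromℚᵘ (ℚᵘ.mkℚᵘ k 0) ⟨
  toℚᵘ (fromℤ k) ∎)
  where open ℚᵘ.≃-Reasoning

complement : ℚ → ℚ
complement q = 1ℚ ℚ.- q

[1-p]*q : ∀ p q → (1ℚ ℚ.- p) ℚ.* q ≡ q ℚ.- p ℚ.* q
[1-p]*q p q = begin
  (1ℚ ℚ.- p) ℚ.* q             ≡⟨ ℚ.*-distribʳ-+ q 1ℚ (ℚ.- p) ⟩
  1ℚ ℚ.* q ℚ.+ (ℚ.- p) ℚ.* q   ≡⟨ cong₂ ℚ._+_ (ℚ.*-identityˡ q) (sym (ℚ.neg-distribˡ-* p q)) ⟩
  q ℚ.- p ℚ.* q                ∎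
  where open ≡-Reasoning

1-[1-p] : ∀ p → 1ℚ ℚ.- (1ℚ ℚ.- p) ≡ p
1-[1-p] p = begin
  1ℚ ℚ.+ ℚ.- (1ℚ ℚ.- p)              ≡⟨ cong (1ℚ ℚ.+_) (ℚ.neg-distrib-+ 1ℚ (ℚ.- p)) ⟩
  1ℚ ℚ.+ (ℚ.- 1ℚ ℚ.+ ℚ.- (ℚ.- p))    ≡⟨ ℚ.+-assoc 1ℚ (ℚ.- 1ℚ) (ℚ.- (ℚ.- p)) ⟨
  0ℚ ℚ.+ ℚ.- (ℚ.- p)                 ≡⟨ ℚ.+-identityˡ _ ⟩
  ℚ.- (ℚ.- p)                        ≡⟨ ⁻¹-involutive ℚ.+-0-group p ⟩
  p                                  ∎
  where open ≡-Reasoning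

1-anti-< : ∀ {p q} → p ℚ.< q → 1ℚ ℚ.- q ℚ.< 1ℚ ℚ.- p
1-anti-< p<q = ℚ.+-monoʳ-< 1ℚ (ℚ.neg-antimono-< p<q)

⟨⟩-negʳ : ∀ {n} (v f : Vec ℤ n) → ⟨ v , Vec.map ℤ.-_ f ⟩ ≡ ℤ.- ⟨ v , f ⟩
⟨⟩-negʳ []      []      = refl
⟨⟩-negʳ (x ∷ v) (y ∷ f) = begin
  x ℤ.* (ℤ.- y) ℤ.+ ⟨ v , Vec.map ℤ.-_ f ⟩   ≡⟨ cong₂ ℤ._+_ (sym (ℤ.neg-distribʳ-* x y)) (⟨⟩-negʳ v f) ⟩
  ℤ.- (x ℤ.* y) ℤ.+ ℤ.- ⟨ v , f ⟩            ≡⟨ ℤ.neg-distrib-+ (x ℤ.* y) ⟨ v , f ⟩ ⟨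
  ℤ.- (x ℤ.* y ℤ.+ ⟨ v , f ⟩)                ∎
  where open ≡-Reasoning

-- Lists and vectors.

take-length-++ : ∀ (xs ys : List A) → take (length xs) (xs ++ ys) ≡ xs
take-length-++ []       ys = refl
take-length-++ (x ∷ xs) ys = cong (x ∷_) (take-length-++ xs ys)

drop-length-++ : ∀ (xs ys : List A) → drop (length xs) (xs ++ ys) ≡ ys
drop-length-++ []       ys = refl
drop-length-++ (x ∷ xs) ys = drop-length-++ xs ys

module _ {R : Rel A ℓ} where

  AllPairs-++⁻ : ∀ xs {ys} → AllPairs R (xs ++ ys) → AllPairs R xs × AllPairs R ys
  AllPairs-++⁻ []       Rys        = [] , Rys
  AllPairs-++⁻ (x ∷ xs) (Rx ∷ Rxs) =
    All.++⁻ˡ xs Rx ∷ proj₁ (AllPairs-++⁻ xs Rxs) , proj₂ (AllPairs-++⁻ xs Rxs)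

  AllPairs-map-All : ∀ {S : Rel A ℓ′} {P : Pred A ℓ} {xs} →
    (∀ {x y} → P x → P y → R x y → S x y) →
    All P xs → AllPairs R xs → AllPairs S xs
  AllPairs-map-All f []         []         = []
  AllPairs-map-All f (px ∷ pxs) (Rx ∷ Rxs) =
    All.zipWith (λ (py , Rxy) → f px py Rxy) (pxs , Rx) ∷ AllPairs-map-All f pxs Rxs

module _ (_≟_ : DecidableEquality A) where

  -- The first `c` filters out the rest of its run and leaves `ys` intact, as `ys` avoids `c`. This
  -- is how a block with constant `d` contributes exactly one value c_a.
  deduplicate-const-++ : ∀ c xs ys → xs ≢ [] → All (_≡ c) xs → All (c ≢_) ys →
    deduplicate _≟_ (xs ++ ys) ≡ c ∷ deduplicate _≟_ ys
  deduplicate-const-++ c []           ys ≢[] _           c∉ys = contradiction refl ≢[]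
  deduplicate-const-++ c (x ∷ [])     ys _ (refl ∷ [])   c∉ys =
    cong (c ∷_) (List.filter-all (¬? ∘ (c ≟_)) (All.deduplicate⁺ _≟_ c∉ys))
  deduplicate-const-++ c (x ∷ y ∷ xs) ys _ (refl ∷ y∷xs) c∉ys = cong (c ∷_) (begin
    filter ≢c? (deduplicate _≟_ ((y ∷ xs) ++ ys))
      ≡⟨ cong (filter ≢c?) (deduplicate-const-++ c (y ∷ xs) ys (λ ()) y∷xs c∉ys) ⟩
    filter ≢c? (c ∷ deduplicate _≟_ ys)
      ≡⟨ List.filter-reject ≢c? (λ c≢c → c≢c refl) ⟩
    filter ≢c? (deduplicate _≟_ ys)
      ≡⟨ List.filter-all ≢c? (All.deduplicate⁺ _≟_ c∉ys) ⟩
    deduplicate _≟_ ys ∎)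
    where
    open ≡-Reasoning
    ≢c? = ¬? ∘ (c ≟_)

headOr : A → List A → A
headOr e []      = e
headOr e (x ∷ _) = x

-- List counterpart of the tabulation that defines the y-component of `Ξ`, where each entry depends
-- on c_a and c_{a+1}; `e` plays the part of c_t = 1 after the last interior value.
consecutive : (A → A → B) → List A → A → List B
consecutive f []       e = []
consecutive f (x ∷ xs) e = f x (headOr e xs) ∷ consecutive f xs e

tabulate-consecutive : ∀ (f : A → A → B) xs e →
  let v = Vec.fromList xs Vec.∷ʳ e in
  Vec.toList (Vec.tabulate λ i → f (lookup v (inject₁ i)) (lookup v (Fin.suc i))) ≡ consecutive f xs e
tabulate-consecutive f []           e = refl
tabulate-consecutive f (x ∷ [])     e = refl
tabulate-consecutive f (x ∷ y ∷ xs) e = cong (f x y ∷_) (tabulate-consecutive f (y ∷ xs) e)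

toList-fromList-∷ʳ : ∀ (xs : List A) e → Vec.toList (Vec.fromList xs Vec.∷ʳ e) ≡ xs ++ [ e ]
toList-fromList-∷ʳ xs e = trans (Vec.toList-∷ʳ e (Vec.fromList xs))
                                (cong (_++ [ e ]) (Vec.toList∘fromList xs))

toList-init-last : ∀ {n} (xs : Vec A (suc n)) →
  Vec.toList xs ≡ Vec.toList (Vec.init xs) ++ [ Vec.last xs ]
toList-init-last xs = trans (cong Vec.toList (proj₂ (proj₂ (Vec.initLast xs))))
                            (Vec.toList-∷ʳ (Vec.last xs) (Vec.init xs))

-- Deduplication keeps the head, and the head of a sorted list is its minimum.
headOr-≤ : ∀ {xs e q} → AllPairs ℚ._≤_ xs → q ∈ˡ xs →
  headOr e (deduplicate ℚ._≟_ xs) ℚ.≤ q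
headOr-≤ (x≤ ∷ _) (here refl)  = ℚ.≤-refl
headOr-≤ (x≤ ∷ _) (there q∈xs) = All.lookup x≤ q∈xs

module _ {R : Rel A ℓ} (R-trans : Transitive R) where

  linked-head : ∀ {n x y} {xs : Vec A n} → Linkedᵛ R (x ∷ xs) → y ∈ xs → R x y
  linked-head (r ∷ rs) (here refl) = r
  linked-head (r ∷ rs) (there y∈)  = R-trans r (linked-head rs y∈)

  linked-last : ∀ {n x} {xs : Vec A (suc n)} → Linkedᵛ R (x ∷ xs) → R x (Vec.last xs)
  linked-last {xs = _ ∷ []}    (r ∷ _)  = r
  linked-last {xs = _ ∷ _ ∷ _} (r ∷ rs) = R-trans r (linked-last rs)

splitAt-< : ∀ (f : A → ℚ) q xs → AllPairs (λ x y → f x ℚ.≤ f y) xs →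
  ∃[ ys ] ∃[ zs ] xs ≡ ys ++ zs × All (λ x → f x ℚ.< q) ys × All (λ x → q ℚ.≤ f x) zs
splitAt-< f q []       []         = [] , [] , refl , [] , []
splitAt-< f q (x ∷ xs) (x≤ ∷ xs≤) with f x ℚ.<? q
... | no  fx≮q = [] , x ∷ xs , refl , [] , q≤fx ∷ All.map (ℚ.≤-trans q≤fx) x≤
  where q≤fx = ℚ.≮⇒≥ fx≮q
... | yes fx<q with splitAt-< f q xs xs≤
...   | ys , zs , refl , ys<q , q≤zs = x ∷ ys , zs , refl , fx<q ∷ ys<q , q≤zs

-- Membership in Inv(λ) in terms of the sign and the value of `d`.

Range : Sign → ℚ → Set
Range Sign.+ q = 0ℚ ℚ.≤ q × q ℚ.< 1ℚ
Range Sign.- q = 0ℚ ℚ.< q × q ℚ.≤ 1ℚ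

module Inversions (R : RootSystem) (lam : RootSystem.P R) (_◁_ : Rel (RootSystem.Δ⁺ R) 0ℓ) where
  open RootSystem R
  open Shape R lam _◁_ using (Block; AffineCoroot; _+_δ; bar; d; Inv; IsPositive)

  sign : AffineCoroot → Sign
  sign β = proj₁ (bar β)

  label : AffineCoroot → Δ⁺
  label β = proj₂ (bar β)

  pairing-pos : ∀ s a → Block s a → 0ℤ ℤ.< ⟪ lam , (s , a) ∨⟫
  pairing-pos Sign.+ a pos = pos
  pairing-pos Sign.- a neg rewrite ⟨⟩-negʳ lam (coroot⁺ a) = ℤ.neg-mono-< neg

  pairing-block : ∀ s a → 0ℤ ℤ.< ⟪ lam , (s , a) ∨⟫ → Block s a
  pairing-block Sign.+ a pos = pos
  pairing-block Sign.- a pos rewrite ⟨⟩-negʳ lam (coroot⁺ a) = ℤ.neg-cancel-< pos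

  -- Clearing the denominator replaces the case distinction in `d` by one equation, from which all
  -- bounds on `d` are derived.
  d-* : ∀ γ k → 0ℤ ℤ.< ⟪ lam , γ ∨⟫ → d (γ + k δ) ℚ.* fromℤ ⟪ lam , γ ∨⟫ ≡ fromℤ k
  d-* γ k pos with ⟪ lam , γ ∨⟫
  ... | +[1+ n ] = /-*-cancel k n
  d-* γ k (ℤ.+<+ ()) | + 0

  private
    i-j<0 : ∀ i j → i ℤ.< j → i ℤ.- j ℤ.< 0ℤ
    i-j<0 i j i<j = subst (i ℤ.- j ℤ.<_) (ℤ.+-inverseʳ j) (ℤ.+-monoˡ-< (ℤ.- j) i<j)

  nonNeg⇒positive : ∀ {a k} → 0ℤ ℤ.≤ k → IsPositive ((Sign.+ , a) + k δ)
  nonNeg⇒positive {k = + 0}      _ = inj₂ (refl , refl)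
  nonNeg⇒positive {k = +[1+ n ]} _ = inj₁ (ℤ.+<+ ℕ.z<s)

  -- The degrees `k` of inversions over a root of sign s whose pairing with λ is `p`. The two signs
  -- differ at the ends because an affine coroot of degree 0 is positive exactly when its root is:
  -- `k` = 0 is allowed only for positive roots, and `k` = `p`, where the translate has degree 0,
  -- only for negative ones. `Range` is the same condition divided by `p`.
  IntRange : Sign → ℤ → ℤ → Set
  IntRange Sign.+ k p = 0ℤ ℤ.≤ k × k ℤ.< p
  IntRange Sign.- k p = 0ℤ ℤ.< k × k ℤ.≤ p

  inv⇒intRange : ∀ s a k → Inv ((s , a) + k δ) → IntRange s k ⟪ lam , (s , a) ∨⟫
  inv⇒intRange Sign.+ a k (pos , neg) = 0≤k pos , k<p
    where
    0≤k : IsPositive ((Sign.+ , a) + k δ) → 0ℤ ℤ.≤ k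
    0≤k (inj₁ 0<k)        = ℤ.<⇒≤ 0<k
    0≤k (inj₂ (refl , _)) = ℤ.≤-refl
    k<p : k ℤ.< ⟪ lam , (Sign.+ , a) ∨⟫
    k<p = ℤ.≰⇒> λ p≤k → neg (nonNeg⇒positive {a} (ℤ.i≤j⇒0≤j-i p≤k))
  inv⇒intRange Sign.- a k (inj₁ 0<k , neg) = 0<k , ℤ.≮⇒≥ λ p<k → neg (inj₁ (0<k-p p<k))
    where
    0<k-p : ∀ {p} → p ℤ.< k → 0ℤ ℤ.< k ℤ.- p
    0<k-p {p} p<k = subst (ℤ._< k ℤ.- p) (ℤ.+-inverseʳ p) (ℤ.+-monoˡ-< (ℤ.- p) p<k)

  intRange⇒inv : ∀ s a k → IntRange s k ⟪ lam , (s , a) ∨⟫ → Inv ((s , a) + k δ)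
  intRange⇒inv Sign.+ a k (0≤k , k<p) = nonNeg⇒positive {a} 0≤k , λ where
      (inj₁ 0<k-p)        → ℤ.<-asym 0<k-p (i-j<0 _ _ k<p)
      (inj₂ (k-p≡0 , _))  → ℤ.<-irrefl k-p≡0 (i-j<0 _ _ k<p)
  intRange⇒inv Sign.- a k (0<k , k≤p) = inj₁ 0<k , λ where
      (inj₁ 0<k-p)    → ℤ.<⇒≱ 0<k-p (ℤ.i≤j⇒i-j≤0 k≤p)
      (inj₂ (_ , ()))

  intRange⇒0<p : ∀ s {k p} → IntRange s k p → 0ℤ ℤ.< p
  intRange⇒0<p Sign.+ (0≤k , k<p) = ℤ.≤-<-trans 0≤k k<p
  intRange⇒0<p Sign.- (0<k , k≤p) = ℤ.<-≤-trans 0<k k≤p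

  module _ {c k p} (0<p : 0ℤ ℤ.< p) (c*p≡k : c ℚ.* fromℤ p ≡ fromℤ k) where
    private instance
      p-pos : ℚ.Positive (fromℤ p)
      p-pos = ℚ.positive (fromℤ-mono-< 0<p)
      p-nonNeg : ℚ.NonNegative (fromℤ p)
      p-nonNeg = ℚ.nonNegative (fromℤ-mono-≤ (ℤ.<⇒≤ 0<p))

    private
      0*p = ℚ.*-zeroˡ (fromℤ p)
      1*p = ℚ.*-identityˡ (fromℤ p)

    -- Multiplication by `p` > 0 carries the bounds 0 and 1 on `c` to the bounds 0 and `p` on `k`,
    -- and preserves and reflects both kinds of inequality.
    intRange⇒range : ∀ s → IntRange s k p → Range s c
    intRange⇒range Sign.+ (0≤k , k<p) =
      ℚ.*-cancelʳ-≤-pos (fromℤ p) (subst₂ ℚ._≤_ (sym 0*p) (sym c*p≡k) (fromℤ-mono-≤ 0≤k)) ,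
      ℚ.*-cancelʳ-<-nonNeg (fromℤ p) (subst₂ ℚ._<_ (sym c*p≡k) (sym 1*p) (fromℤ-mono-< k<p))
    intRange⇒range Sign.- (0<k , k≤p) =
      ℚ.*-cancelʳ-<-nonNeg (fromℤ p) (subst₂ ℚ._<_ (sym 0*p) (sym c*p≡k) (fromℤ-mono-< 0<k)) ,
      ℚ.*-cancelʳ-≤-pos (fromℤ p) (subst₂ ℚ._≤_ (sym c*p≡k) (sym 1*p) (fromℤ-mono-≤ k≤p))

    range⇒intRange : ∀ s → Range s c → IntRange s k p
    range⇒intRange Sign.+ (0≤c , c<1) =
      fromℤ-cancel-≤ (subst₂ ℚ._≤_ 0*p c*p≡k (ℚ.*-monoʳ-≤-nonNeg (fromℤ p) 0≤c)) ,
      fromℤ-cancel-< (subst₂ ℚ._<_ c*p≡k 1*p (ℚ.*-monoˡ-<-pos (fromℤ p) c<1))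
    range⇒intRange Sign.- (0<c , c≤1) =
      fromℤ-cancel-< (subst₂ ℚ._<_ 0*p c*p≡k (ℚ.*-monoˡ-<-pos (fromℤ p) 0<c)) ,
      fromℤ-cancel-≤ (subst₂ ℚ._≤_ c*p≡k 1*p (ℚ.*-monoʳ-≤-nonNeg (fromℤ p) c≤1))

  inv⇒block : ∀ β → Inv β → Block (sign β) (label β)
  inv⇒block ((s , a) + k δ) inv =
    pairing-block s a (intRange⇒0<p s (inv⇒intRange s a k inv))

  inv⇒range : ∀ β → Inv β → Range (sign β) (d β)
  inv⇒range ((s , a) + k δ) inv = intRange⇒range 0<p (d-* (s , a) k 0<p) s kp
    where
    kp  = inv⇒intRange s a k inv
    0<p = intRange⇒0<p s kp

  -- From σ⟨λ, a^∨⟩ ∈ ℤ the degree ⟨λ, (s a)^∨⟩ - σ⟨λ, (s a)^∨⟩ is an integer.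
  lift : ∀ s a σ → Block s a → IsIntegral (σ ℚ.* fromℤ ⟪ lam , a ⁺∨⟫) → Range s (1ℚ ℚ.- σ) →
    ∃[ k ] d ((s , a) + k δ) ≡ 1ℚ ℚ.- σ × Inv ((s , a) + k δ)
  lift s a σ blk int rng = k , d≡ , intRange⇒inv s a k (range⇒intRange 0<p ck s rng)
    where
    p = ⟪ lam , (s , a) ∨⟫
    0<p : 0ℤ ℤ.< p
    0<p = pairing-pos s a blk
    -- Integrality is given for the positive coroot; for a negative root both the pairing and the
    -- witnessing integer change sign.
    signed : ∀ s → IsIntegral (σ ℚ.* fromℤ ⟪ lam , (s , a) ∨⟫)
    signed Sign.+ = int
    signed Sign.- rewrite ⟨⟩-negʳ lam (coroot⁺ a) = ℤ.- proj₁ int , (begin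
      σ ℚ.* fromℤ (ℤ.- ⟪ lam , a ⁺∨⟫)   ≡⟨ cong (σ ℚ.*_) (fromℤ-homo-neg ⟪ lam , a ⁺∨⟫) ⟩
      σ ℚ.* ℚ.- fromℤ ⟪ lam , a ⁺∨⟫     ≡⟨ ℚ.neg-distribʳ-* σ _ ⟨
      ℚ.- (σ ℚ.* fromℤ ⟪ lam , a ⁺∨⟫)   ≡⟨ cong ℚ.-_ (proj₂ int) ⟩
      ℚ.- fromℤ (proj₁ int)             ≡⟨ fromℤ-homo-neg (proj₁ int) ⟨
      fromℤ (ℤ.- proj₁ int)             ∎)
      where open ≡-Reasoning
    j k : ℤ
    j = proj₁ (signed s)
    k = p ℤ.- j
    ck : (1ℚ ℚ.- σ) ℚ.* fromℤ p ≡ fromℤ k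
    ck = begin
      (1ℚ ℚ.- σ) ℚ.* fromℤ p       ≡⟨ [1-p]*q σ (fromℤ p) ⟩
      fromℤ p ℚ.- σ ℚ.* fromℤ p    ≡⟨ cong (λ q → fromℤ p ℚ.- q) (proj₂ (signed s)) ⟩
      fromℤ p ℚ.- fromℤ j          ≡⟨ cong (fromℤ p ℚ.+_) (fromℤ-homo-neg j) ⟨
      fromℤ p ℚ.+ fromℤ (ℤ.- j)    ≡⟨ fromℤ-homo-+ p (ℤ.- j) ⟨
      fromℤ k                      ∎
      where open ≡-Reasoning
    d≡ : d ((s , a) + k δ) ≡ 1ℚ ℚ.- σ
    -- Both sides become `k` after multiplication by `p`; cancelling `p` in the two inequalities
    -- gives the equation.
    d≡ = ℚ.≤-antisym (cancel (ℚ.≤-reflexive e)) (cancel (ℚ.≤-reflexive (sym e)))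
      where
      e = trans (d-* (s , a) k 0<p) (sym ck)
      cancel : ∀ {x y} → x ℚ.* fromℤ p ℚ.≤ y ℚ.* fromℤ p → x ℚ.≤ y
      cancel = ℚ.*-cancelʳ-≤-pos (fromℤ p) {{ℚ.positive (fromℤ-mono-< 0<p)}}

-- Equality of triples, the order on affine coroots, and concatenation of label paths.

module Chains (R : RootSystem) (lam : RootSystem.P R) (_◁_ : Rel (RootSystem.Δ⁺ R) 0ℓ)
              (◁-order : IsStrictTotalOrder _≡_ _◁_) where
  open RootSystem R
  open WeylGroup R
  open Shape R lam _◁_
  open Inversions R lam _◁_
  private module ◁ = IsStrictTotalOrder ◁-order

  -- The vectors have types depending on `m`, so the components are compared as lists; the equality
  -- of the two values of `m` is recovered from the length of `y`.
  triple-≡ : ∀ {η η′ : Triple} → let open Triple in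
    Vec.toList (x η) ≡ Vec.toList (x η′) →
    Vec.toList (y η) ≡ Vec.toList (y η′) →
    Vec.toList (σ η) ≡ Vec.toList (σ η′) → η ≡ η′
  triple-≡ {triple m x y σ} {triple m′ x′ y′ σ′} x≡ y≡ σ≡ = go m≡ x y σ x≡ y≡ σ≡
    where
    m≡ : m ≡ m′
    m≡ = trans (sym (Vec.length-toList y)) (trans (cong length y≡) (Vec.length-toList y′))
    toList-inj : ∀ {A : Set} {n} (v w : Vec A n) → Vec.toList v ≡ Vec.toList w → v ≡ w
    toList-inj v w eq = trans (sym (Vec.cast-is-id refl v)) (Vec.toList-injective refl v w eq)
    go : ∀ {m} → m ≡ m′ → (x : Vec W (suc m)) (y : Vec W m) (σ : Vec ℚ (suc (suc m))) →
      Vec.toList x ≡ Vec.toList x′ → Vec.toList y ≡ Vec.toList y′ →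
      Vec.toList σ ≡ Vec.toList σ′ → triple m x y σ ≡ triple m′ x′ y′ σ′
    go refl x y σ x≡ y≡ σ≡
      with refl ← toList-inj x x′ x≡ | refl ← toList-inj y y′ y≡ | refl ← toList-inj σ σ′ σ≡
      = refl

  ≺-trans : ∀ γ γ′ γ″ → γ ≺ γ′ → γ′ ≺ γ″ → γ ≺ γ″
  ≺-trans (Sign.+ , _) (Sign.+ , _) (Sign.+ , _) a◁b b◁c = ◁.trans a◁b b◁c
  ≺-trans (Sign.+ , _) (Sign.+ , _) (Sign.- , _) _   _   = tt
  ≺-trans (Sign.+ , _) (Sign.- , _) (Sign.- , _) _   _   = tt
  ≺-trans (Sign.- , _) (Sign.- , _) (Sign.- , _) a◁b b◁c = ◁.trans a◁b b◁c

  ≺-irrefl : ∀ γ → ¬ (γ ≺ γ)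
  ≺-irrefl (Sign.+ , _) = ◁.irrefl refl
  ≺-irrefl (Sign.- , _) = ◁.irrefl refl

  <ᴵ-trans : Transitive _<ᴵ_
  <ᴵ-trans (inj₁ p)       (inj₁ q)        = inj₁ (ℚ.<-trans p q)
  <ᴵ-trans {β} (inj₁ p)   (inj₂ (e , _))  = inj₁ (subst (d β ℚ.<_) e p)
  <ᴵ-trans {k = β} (inj₂ (e , _)) (inj₁ q) = inj₁ (subst (ℚ._< d β) (sym e) q)
  <ᴵ-trans {β} {β′} {β″} (inj₂ (e , p)) (inj₂ (e′ , q)) =
    inj₂ (trans e e′ , ≺-trans (bar β″) (bar β′) (bar β) q p)

  <ᴵ-irrefl : ∀ β → ¬ (β <ᴵ β)
  <ᴵ-irrefl β (inj₁ p)       = ℚ.<-irrefl refl p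
  <ᴵ-irrefl β (inj₂ (_ , p)) = ≺-irrefl (bar β) p

  <ᴵ⇒d≤ : ∀ {β β′} → β <ᴵ β′ → d β ℚ.≤ d β′
  <ᴵ⇒d≤ (inj₁ p)       = ℚ.<⇒≤ p
  <ᴵ⇒d≤ (inj₂ (e , _)) = ℚ.≤-reflexive e

  labels⁺ : List AffineCoroot → List Δ⁺
  labels⁺ = map label

  target : W → List AffineCoroot → W
  target x L = foldl _·s_ x (labels⁺ L)

  target-++ : ∀ x L L′ → target x (L ++ L′) ≡ target (target x L) L′
  target-++ x L L′ = trans (cong (foldl _·s_ x) (List.map-++ label L L′))
                           (List.foldl-++ _·s_ x (labels⁺ L) (labels⁺ L′))

  path-target : ∀ {x as y} → Path x as y → foldl _·s_ x as ≡ y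
  path-target []                = refl
  path-target ((refl , _) ∷ p) = path-target p

  path-++⁺ : ∀ {x as y bs z} → Path x as y → Path y bs z → Path x (as ++ bs) z
  path-++⁺ []      q = q
  path-++⁺ (e ∷ p) q = e ∷ path-++⁺ p q

  -- An edge determines its endpoint from its source and label, so the vertex at the cut is the fold
  -- of the first labels.
  path-++⁻ : ∀ {x} as {bs z} → Path x (as ++ bs) z →
    Path x as (foldl _·s_ x as) × Path (foldl _·s_ x as) bs z
  path-++⁻ []       p                = [] , p
  path-++⁻ (a ∷ as) (e@(refl , _) ∷ p) = e ∷ proj₁ (path-++⁻ as p) , proj₂ (path-++⁻ as p)

  -- Segments of constant sign and constant `d`.

  At : Sign → ℚ → AffineCoroot → Set
  At s c β = sign β ≡ s × d β ≡ c × Inv β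

  ≺⇒◁ : ∀ s {a b} → (s , a) ≺ (s , b) → a ◁ b
  ≺⇒◁ Sign.+ p = p
  ≺⇒◁ Sign.- p = p

  ◁⇒≺ : ∀ s {a b} → a ◁ b → (s , a) ≺ (s , b)
  ◁⇒≺ Sign.+ p = p
  ◁⇒≺ Sign.- p = p

  <ᴵ⇒▷ : ∀ {s c β β′} → At s c β → At s c β′ → β <ᴵ β′ → label β′ ◁ label β
  <ᴵ⇒▷     (_ , e , _)    (_ , e′ , _)   (inj₁ p)       = contradiction p (ℚ.<-irrefl (trans e (sym e′)))
  <ᴵ⇒▷ {s} (refl , _ , _) (refl , _ , _) (inj₂ (_ , p)) = ≺⇒◁ s p

  ▷⇒<ᴵ : ∀ {s c β β′} → At s c β → At s c β′ → label β′ ◁ label β → β <ᴵ β′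
  ▷⇒<ᴵ {s} (refl , e , _) (refl , e′ , _) p = inj₂ (trans e (sym e′) , ◁⇒≺ s p)

  record Segment (s : Sign) (c : ℚ) (x y : W) (L : List AffineCoroot) : Set where
    constructor segment
    field
      path   : Path x (labels⁺ L) y
      at     : All (At s c) L
      sorted : AllPairs _<ᴵ_ L

  -- The conclusion is at σ = 1, where integrality is automatic, so `c` may be arbitrary. This form
  -- serves the two end conditions.
  segment⇒⟹ : ∀ {s c x y L} → Segment s c x y L → x ⟹[ s ] y
  segment⇒⟹ {s} {L = L} (segment path at sorted) =
    labels⁺ L , path ,
    All.map⁺ (All.map (λ {β} (e , _ , inv) → subst (λ s → Block s (label β)) e (inv⇒block β inv)) at) ,
    Linked.AllPairs⇒Linked (AllPairs.map⁺ (AllPairs-map-All <ᴵ⇒▷ at sorted)) ,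
    All.universal (λ γ → ⟪ lam , γ ⁺∨⟫ , ℚ.*-identityˡ _) (labels⁺ L)

  -- Each label lifts by `lift` to an inversion with `d` equal to 1 - σ. Since sign and `d` are then
  -- constant, the descending labels become increasing affine coroots.
  ⟹⇒segment : ∀ s σ {x y} → x ⟹[ s ∣ σ ] y → Range s (1ℚ ℚ.- σ) → ∃[ L ] Segment s (1ℚ ℚ.- σ) x y L
  ⟹⇒segment s σ {x} {y} (γs , path , blocks , linked , ints) rng = go (lifts blocks ints)
    where
    lifts : ∀ {γs} → All (Block s) γs → All (λ γ → IsIntegral (σ ℚ.* fromℤ ⟪ lam , γ ⁺∨⟫)) γs →
      ∃[ L ] labels⁺ L ≡ γs × All (At s (1ℚ ℚ.- σ)) L
    lifts []               []       = [] , refl , []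
    lifts (_∷_ {γ} b bs) (i ∷ is) with lift s γ σ b i rng | lifts bs is
    ... | k , d≡ , inv | L , refl , at = (s , γ) + k δ ∷ L , refl , (refl , d≡ , inv) ∷ at
    go : ∃[ L ] labels⁺ L ≡ γs × All (At s (1ℚ ℚ.- σ)) L → ∃[ L ] Segment s (1ℚ ℚ.- σ) x y L
    go (L , refl , at) = L , segment path at
      (AllPairs-map-All ▷⇒<ᴵ at
        (AllPairs.map⁻ (Linked.Linked⇒AllPairs (flip ◁.trans) linked)))

  -- Block decompositions.

  next : List ℚ → ℚ
  next = headOr 1ℚ

  -- The chosen affine coroots L of an admissible subset, from the first value
  -- of d in (0, 1) onwards: blocks at c₁ < c₂ < …, followed by a block at 1.
  data Blocks (v : W) : W → List ℚ → List W → List W → List AffineCoroot → Set where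
    last : ∀ {x L} → Segment Sign.- 1ℚ x v L → Blocks v x [] [] [] L
    step : ∀ {c x y x′ cs xs ys N P L} →
      0ℚ ℚ.< c → c ℚ.< 1ℚ → All (c ℚ.<_) cs → x ≢ x′ →
      Segment Sign.- c x y N → Segment Sign.+ c y x′ P →
      Blocks v x′ cs xs ys L →
      Blocks v x (c ∷ cs) (x′ ∷ xs) (y ∷ ys) ((N ++ P) ++ L)

  private
    at-d : ∀ {s c L} → All (At s c) L → All (λ β → d β ≡ c) L
    at-d = All.map λ (_ , e , _) → e

    block-d : ∀ {c x y z N P} → Segment Sign.- c x y N → Segment Sign.+ c y z P →
      All (λ β → d β ≡ c) (N ++ P)
    block-d n p = All.++⁺ (at-d (Segment.at n)) (at-d (Segment.at p))

  segment-target : ∀ {s c x y L} → Segment s c x y L → target x L ≡ y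
  segment-target = path-target ∘ Segment.path

  blocks-d> : ∀ {v x cs xs ys L q} → Blocks v x cs xs ys L → q ℚ.< 1ℚ → All (q ℚ.<_) cs →
    All (λ β → q ℚ.< d β) L
  blocks-d> {q = q} (last s) q<1 _ = All.map (λ e → subst (q ℚ.<_) (sym e) q<1) (at-d (Segment.at s))
  blocks-d> {q = q} (step _ _ _ _ n p bs) q<1 (q<c ∷ q<cs) =
    All.++⁺ (All.map (λ e → subst (q ℚ.<_) (sym e) q<c) (block-d n p)) (blocks-d> bs q<1 q<cs)

  blocks-d≥ : ∀ {v x cs xs ys L} → Blocks v x cs xs ys L → All (λ β → next cs ℚ.≤ d β) L
  blocks-d≥ (last s) = All.map (ℚ.≤-reflexive ∘ sym) (at-d (Segment.at s))
  blocks-d≥ (step _ c<1 c<cs _ n p bs) =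
    All.++⁺ (All.map (ℚ.≤-reflexive ∘ sym) (block-d n p)) (All.map ℚ.<⇒≤ (blocks-d> bs c<1 c<cs))

  <next : ∀ {q cs} → q ℚ.< 1ℚ → All (q ℚ.<_) cs → q ℚ.< next cs
  <next q<1 []        = q<1
  <next q<1 (q<c ∷ _) = q<c

  blocks-0<next : ∀ {v x cs xs ys L} → Blocks v x cs xs ys L → 0ℚ ℚ.< next cs
  blocks-0<next (last _)                = ℚ.positive⁻¹ 1ℚ
  blocks-0<next (step 0<c _ _ _ _ _ _) = 0<c

  labels-++ : ∀ {x y z} L {L′} → Path x (labels⁺ L) y → Path y (labels⁺ L′) z →
    Path x (labels⁺ (L ++ L′)) z
  labels-++ L {L′} p q = subst (λ as → Path _ as _) (sym (List.map-++ label L L′)) (path-++⁺ p q)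

  blocks-path : ∀ {v x cs xs ys L} → Blocks v x cs xs ys L → Path x (labels⁺ L) v
  blocks-path (last s) = Segment.path s
  blocks-path (step {N = N} {P} _ _ _ _ n p bs) =
    labels-++ (N ++ P) (labels-++ N (Segment.path n) (Segment.path p)) (blocks-path bs)

  blocks-inv : ∀ {v x cs xs ys L} → Blocks v x cs xs ys L → All Inv L
  blocks-inv (last s) = All.map (λ (_ , _ , inv) → inv) (Segment.at s)
  blocks-inv (step _ _ _ _ n p bs) =
    All.++⁺ (All.++⁺ (All.map (λ (_ , _ , inv) → inv) (Segment.at n))
                     (All.map (λ (_ , _ , inv) → inv) (Segment.at p)))
            (blocks-inv bs)

  sorted-++ : ∀ {L L′ q} → AllPairs _<ᴵ_ L → AllPairs _<ᴵ_ L′ →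
    All (λ β → d β ≡ q) L → All (λ β → q ℚ.< d β) L′ → AllPairs _<ᴵ_ (L ++ L′)
  sorted-++ s s′ d≡q q<d = AllPairs.++⁺ s s′
    (All.map (λ e → All.map (λ {β} lt → inj₁ (subst (ℚ._< d β) (sym e) lt)) q<d) d≡q)

  blocks-sorted : ∀ {v x cs xs ys L} → Blocks v x cs xs ys L → AllPairs _<ᴵ_ L
  blocks-sorted (last s) = Segment.sorted s
  blocks-sorted (step _ c<1 c<cs _ n p bs) = sorted-++
    (AllPairs.++⁺ (Segment.sorted n) (Segment.sorted p)
      (All.map (λ at → All.map (neg<pos at) (Segment.at p)) (Segment.at n)))
    (blocks-sorted bs) (block-d n p) (blocks-d> bs c<1 c<cs)
    where
    -- At equal `d` the order `<ᴵ` reverses `≺`, which puts positive roots first; hence the negative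
    -- part precedes the positive part inside a block.
    neg<pos : ∀ {c β β′} → At Sign.- c β → At Sign.+ c β′ → β <ᴵ β′
    neg<pos (refl , e , _) (refl , e′ , _) = inj₂ (trans e (sym e′) , tt)

  interior? = λ q → (0ℚ ℚ.<? q) ×-dec (q ℚ.<? 1ℚ)

  values : List AffineCoroot → List ℚ
  values L = deduplicate ℚ._≟_ (filter interior? (map d L))

  -- Every block is nonempty, because its endpoints differ.
  blocks-values : ∀ {v x cs xs ys L} → Blocks v x cs xs ys L → values L ≡ cs
  blocks-values {L = L} (last s) = cong (deduplicate ℚ._≟_)
    (List.filter-none interior? {xs = map d L}
      (All.map⁺ (All.map (λ e (_ , d<1) → ℚ.<-irrefl e d<1) (at-d (Segment.at s)))))
  blocks-values (step {c} {x} {y} {x′} {cs} {N = N} {P} {L} 0<c c<1 c<cs x≢x′ n p bs) = begin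
    values ((N ++ P) ++ L)
      ≡⟨ cong (deduplicate ℚ._≟_ ∘ filter interior?) (List.map-++ d (N ++ P) L) ⟩
    deduplicate ℚ._≟_ (filter interior? (map d (N ++ P) ++ map d L))
      ≡⟨ cong (deduplicate ℚ._≟_) (List.filter-++ interior? (map d (N ++ P)) (map d L)) ⟩
    deduplicate ℚ._≟_ (filter interior? (map d (N ++ P)) ++ filter interior? (map d L))
      ≡⟨ cong (λ zs → deduplicate ℚ._≟_ (zs ++ filter interior? (map d L)))
           (List.filter-all interior? (All.map (λ { refl → 0<c , c<1 }) d≡c)) ⟩
    deduplicate ℚ._≟_ (map d (N ++ P) ++ filter interior? (map d L))
      ≡⟨ deduplicate-const-++ ℚ._≟_ c (map d (N ++ P)) _ (nonempty (N ++ P) N++P-target) d≡c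
           (All.filter⁺ interior? (All.map⁺ (All.map ℚ.<⇒≢ (blocks-d> bs c<1 c<cs)))) ⟩
    c ∷ values L
      ≡⟨ cong (c ∷_) (blocks-values bs) ⟩
    c ∷ cs ∎
    where
    open ≡-Reasoning
    d≡c : All (_≡ c) (map d (N ++ P))
    d≡c = All.map⁺ (block-d n p)
    N++P-target : target x (N ++ P) ≡ x′
    N++P-target = trans (target-++ x N P) (trans (cong (λ z → target z P) (segment-target n)) (segment-target p))
    nonempty : ∀ L → target x L ≡ x′ → map d L ≢ []
    nonempty [] x≡x′ _ = x≢x′ x≡x′

  count< : ℚ → List AffineCoroot → ℕ
  count< q L = length (filter (λ β → d β ℚ.<? q) L)

  count<-++ : ∀ q {L L′} → All (λ β → d β ℚ.< q) L → All (λ β → q ℚ.≤ d β) L′ →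
    count< q (L ++ L′) ≡ length L
  count<-++ q {L} {L′} L<q q≤L′ = cong length (begin
    filter (λ β → d β ℚ.<? q) (L ++ L′)
      ≡⟨ List.filter-++ (λ β → d β ℚ.<? q) L L′ ⟩
    filter (λ β → d β ℚ.<? q) L ++ filter (λ β → d β ℚ.<? q) L′
      ≡⟨ cong₂ _++_ (List.filter-all (λ β → d β ℚ.<? q) L<q)
           (List.filter-none (λ β → d β ℚ.<? q)
             (All.map (λ q≤d d<q → ℚ.<-irrefl refl (ℚ.<-≤-trans d<q q≤d)) q≤L′)) ⟩
    L ++ []
      ≡⟨ List.++-identityʳ L ⟩
    L ∎)
    where open ≡-Reasoning

  -- Recursion along the QLS path starting at x₁. As σ grows, 1 - σ falls, so each index puts its
  -- block, running from x_{i+1} through y_i to x_i, in front of those already built; this reverses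
  -- the sequences, whence `ʳ++`. The vector `σ` starts at σ₁, the entry σ₀ = 0 having been removed.
  prepend-blocks : ∀ {m} (x : Vec W (suc m)) (y : Vec W m) (σ : Vec ℚ (suc m)) {v cs xs ys L} →
    Linkedᵛ _≢_ x → Linkedᵛ ℚ._<_ σ → Vec.last σ ≡ 1ℚ → 0ℚ ℚ.< Vec.head σ →
    All (1ℚ ℚ.- Vec.head σ ℚ.<_) cs →
    (∀ i → lookup x (Fin.suc i) ⟹[ Sign.- ∣ lookup σ (inject₁ i) ] lookup y i) →
    (∀ i → lookup y i ⟹[ Sign.+ ∣ lookup σ (inject₁ i) ] lookup x (inject₁ i)) →
    Blocks v (Vec.head x) cs xs ys L →
    ∃[ xs′ ] ∃[ L′ ]
      Blocks v (Vec.last x) (map complement (Vec.toList (Vec.init σ)) ʳ++ cs)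
             xs′ (Vec.toList y ʳ++ ys) L′ ×
      Vec.last x ∷ xs′ ≡ Vec.toList x ʳ++ xs
  prepend-blocks (x₁ ∷ []) [] (σ₁ ∷ []) _ _ _ _ _ _ _ bs = _ , _ , bs , refl
  prepend-blocks (x₁ ∷ x₂ ∷ x) (y₁ ∷ y) (σ₁ ∷ σ₂ ∷ σ)
    (x₁≢x₂ ∷ x≢) (σ₁<σ₂ ∷ σ<) last≡1 0<σ₁ c<cs x⟹y y⟹x bs =
    prepend-blocks (x₂ ∷ x) y (σ₂ ∷ σ) x≢ σ< last≡1 (ℚ.<-trans 0<σ₁ σ₁<σ₂)
      (c₂<c₁ ∷ All.map (ℚ.<-trans c₂<c₁) c<cs) (x⟹y ∘ Fin.suc) (y⟹x ∘ Fin.suc)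
      (step 0<c c<1 c<cs (x₁≢x₂ ∘ sym)
        (proj₂ (⟹⇒segment Sign.- σ₁ (x⟹y Fin.zero) (0<c , ℚ.<⇒≤ c<1)))
        (proj₂ (⟹⇒segment Sign.+ σ₁ (y⟹x Fin.zero) (ℚ.<⇒≤ 0<c , c<1)))
        bs)
    where
    -- The value `σ₁` is below the last entry of the increasing vector, which is 1.
    0<c : 0ℚ ℚ.< 1ℚ ℚ.- σ₁
    0<c = 1-anti-< (subst (σ₁ ℚ.<_) last≡1 (linked-last ℚ.<-trans (σ₁<σ₂ ∷ σ<)))
    c<1 : 1ℚ ℚ.- σ₁ ℚ.< 1ℚ
    c<1 = 1-anti-< 0<σ₁
    c₂<c₁ : 1ℚ ℚ.- σ₂ ℚ.< 1ℚ ℚ.- σ₁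
    c₂<c₁ = 1-anti-< σ₁<σ₂

  -- The end condition at ι is stated with σ = 1, but its segment must have `d` = 1 and is therefore
  -- lifted with σ = 0, where integrality holds trivially.
  ⟹-at-0 : ∀ s {x y} → x ⟹[ s ] y → x ⟹[ s ∣ 0ℚ ] y
  ⟹-at-0 s (γs , path , blocks , linked , _) =
    γs , path , blocks , linked , All.universal (λ γ → 0ℤ , ℚ.*-zeroˡ (fromℤ ⟪ lam , γ ⁺∨⟫)) γs

  -- Reading the components of Ξ off a block decomposition.

  module _ (Γ : SuitableChain) (w : W) where
    open SuitableChain Γ
    open Forgetful Γ w

    u-target : ∀ A L {L′} → chosen A ≡ L ++ L′ → u A (length L) ≡ target w L
    u-target A L {L′} eq rewrite eq = cong (foldl _·s_ w) (begin
      take (length L) (labels⁺ (L ++ L′))   ≡⟨ List.take-map (length L) (L ++ L′) ⟩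
      labels⁺ (take (length L) (L ++ L′))   ≡⟨ cong labels⁺ (take-length-++ L L′) ⟩
      labels⁺ L                             ∎)
      where open ≡-Reasoning

    mᶜ-length : ∀ A q {L L′} → chosen A ≡ L ++ L′ →
      All (λ β → d β ℚ.< q) L → All (λ β → q ℚ.≤ d β) L′ → mᶜ A q ≡ length L
    mᶜ-length A q eq L<q q≤L′ = trans (cong (count< q) eq) (count<-++ q L<q q≤L′)

    -- The two counts are the lengths of `L` and of `L ++ (N ++ P)`, so taking and dropping cut out
    -- exactly `N ++ P`, whose negative roots form `N`.
    nᶜ-length : ∀ A q q′ {L N P L′} → chosen A ≡ (L ++ (N ++ P)) ++ L′ →
      mᶜ A q ≡ length L → mᶜ A q′ ≡ length (L ++ (N ++ P)) →
      All (λ β → sign β ≡ Sign.-) N → All (λ β → sign β ≡ Sign.+) P →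
      nᶜ A q q′ ≡ length (L ++ N)
    nᶜ-length A q q′ {L} {N} {P} {L′} eq m≡ m′≡ N- P+ rewrite m≡ | m′≡ | eq = begin
      length L ℕ.+ length (filter isNegativeRoot? (drop (length L) (take (length LNP) (LNP ++ L′))))
        ≡⟨ cong (λ zs → length L ℕ.+ length (filter isNegativeRoot? (drop (length L) zs))) (take-length-++ LNP L′) ⟩
      length L ℕ.+ length (filter isNegativeRoot? (drop (length L) LNP))
        ≡⟨ cong (λ zs → length L ℕ.+ length (filter isNegativeRoot? zs)) (drop-length-++ L (N ++ P)) ⟩
      length L ℕ.+ length (filter isNegativeRoot? (N ++ P))
        ≡⟨ cong (λ zs → length L ℕ.+ length zs) negatives ⟩
      length L ℕ.+ length N
        ≡⟨ List.length-++ L ⟨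
      length (L ++ N) ∎
      where
      open ≡-Reasoning
      LNP = L ++ (N ++ P)
      negatives : filter isNegativeRoot? (N ++ P) ≡ N
      negatives = begin
        filter isNegativeRoot? (N ++ P)
          ≡⟨ List.filter-++ isNegativeRoot? N P ⟩
        filter isNegativeRoot? N ++ filter isNegativeRoot? P
          ≡⟨ cong₂ _++_ (List.filter-all isNegativeRoot? N-)
               (List.filter-none isNegativeRoot? (All.map (λ e e′ → contradiction (trans (sym e) e′) λ ()) P+)) ⟩
        N ++ []
          ≡⟨ List.++-identityʳ N ⟩
        N ∎

    blocks-u-next : ∀ A {v x cs xs ys L} L₀ → Blocks v x cs xs ys L → chosen A ≡ L₀ ++ L →
      target w L₀ ≡ x → All (λ β → d β ℚ.< next cs) L₀ → u A (mᶜ A (next cs)) ≡ x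
    blocks-u-next A L₀ bs eq L₀↦x L₀< =
      trans (cong (u A) (mᶜ-length A _ eq L₀< (blocks-d≥ bs))) (trans (u-target A L₀ eq) L₀↦x)

    -- The prefix `L₀` holds what has been passed: it leads from `w` to `x`, and its values of `d`
    -- lie below the next one. Hence the count at the next value is the length of `L₀`, giving `x`,
    -- and adding the negative part of the block gives `y`. The final 1 contributes the start of the
    -- segment at `d` = 1.
    blocks-u : ∀ A {v x cs xs ys L} L₀ → Blocks v x cs xs ys L → chosen A ≡ L₀ ++ L →
      target w L₀ ≡ x → All (λ β → d β ℚ.< next cs) L₀ →
      map (u A ∘ mᶜ A) (cs ++ [ 1ℚ ]) ≡ x ∷ xs ×
      consecutive (λ q q′ → u A (nᶜ A q q′)) cs 1ℚ ≡ ys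
    blocks-u A L₀ bs@(last s) eq L₀↦x L₀< = cong [_] (blocks-u-next A L₀ bs eq L₀↦x L₀<) , refl
    blocks-u A L₀ bs@(step {c} {x} {y} {x′} {cs} {N = N} {P} {L} 0<c c<1 c<cs _ n p bs′) eq L₀↦x L₀<
      = cong₂ _∷_ (blocks-u-next A L₀ bs eq L₀↦x L₀<) (proj₁ ih) , cong₂ _∷_ u-nᶜ (proj₂ ih)
      where
      L₁ = L₀ ++ (N ++ P)
      eq′ : chosen A ≡ L₁ ++ L
      eq′ = trans eq (sym (List.++-assoc L₀ (N ++ P) L))
      L₀N↦y : target w (L₀ ++ N) ≡ y
      L₀N↦y = trans (target-++ w L₀ N) (trans (cong (λ z → target z N) L₀↦x) (segment-target n))
      L₁↦x′ : target w L₁ ≡ x′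
      L₁↦x′ = begin
        target w (L₀ ++ (N ++ P))   ≡⟨ cong (target w) (List.++-assoc L₀ N P) ⟨
        target w ((L₀ ++ N) ++ P)   ≡⟨ target-++ w (L₀ ++ N) P ⟩
        target (target w (L₀ ++ N)) P   ≡⟨ cong (λ z → target z P) L₀N↦y ⟩
        target y P                  ≡⟨ segment-target p ⟩
        x′                          ∎
        where open ≡-Reasoning
      c<next : c ℚ.< next cs
      c<next = <next c<1 c<cs
      L₁< : All (λ β → d β ℚ.< next cs) L₁
      L₁< = All.++⁺ (All.map (λ lt → ℚ.<-trans lt c<next) L₀<)
                    (All.map (λ e → subst (ℚ._< next cs) (sym e) c<next) (block-d n p))
      u-nᶜ : u A (nᶜ A c (next cs)) ≡ y
      u-nᶜ = trans
        (cong (u A) (nᶜ-length A c (next cs) {L₀} {N} {P} {L} eq′ (mᶜ-length A c eq L₀< (blocks-d≥ bs))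
          (mᶜ-length A (next cs) eq′ L₁< (blocks-d≥ bs′))
          (All.map proj₁ (Segment.at n)) (All.map proj₁ (Segment.at p))))
        (trans (u-target A (L₀ ++ N) (trans eq′ (trans
           (cong (_++ L) (sym (List.++-assoc L₀ N P))) (List.++-assoc (L₀ ++ N) P L)))) L₀N↦y)
      ih = blocks-u A L₁ bs′ eq′ L₁↦x′ L₁<

    -- Subsets of the chain as increasing lists.

    select-∈ : ∀ {n} (βs : Vec AffineCoroot n) A → All (_∈ βs) (select βs A)
    select-∈ []       []          = []
    select-∈ (β ∷ βs) (true ∷ A)  = here refl ∷ All.map there (select-∈ βs A)
    select-∈ (β ∷ βs) (false ∷ A) = All.map there (select-∈ βs A)

    <ᴵ-head : ∀ {n β β′} {βs : Vec AffineCoroot n} → Linkedᵛ _<ᴵ_ (β ∷ βs) → β′ ∈ βs → β <ᴵ β′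
    <ᴵ-head = linked-head λ {β} {β′} {β″} → <ᴵ-trans {β} {β′} {β″}

    select-sorted : ∀ {n} {βs : Vec AffineCoroot n} → Linkedᵛ _<ᴵ_ βs → ∀ A →
      AllPairs _<ᴵ_ (select βs A)
    select-sorted {βs = []}     _  []          = []
    select-sorted {βs = β ∷ βs} lk (true ∷ A)  =
      All.map (<ᴵ-head lk) (select-∈ βs A) ∷ select-sorted (Linkedᵛ.tail lk) A
    select-sorted {βs = β ∷ βs} lk (false ∷ A) = select-sorted (Linkedᵛ.tail lk) A

    ∈-tail : ∀ {n β β′} {βs : Vec AffineCoroot n} → β <ᴵ β′ → β′ ∈ (β ∷ βs) → β′ ∈ βs
    ∈-tail {β = β} β<β (here refl) = contradiction β<β (<ᴵ-irrefl β)
    ∈-tail _           (there β′∈) = β′∈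

    -- Walk down the chain and keep an entry exactly when it is the head of `L`. In either case what
    -- remains of `L` lies strictly above the current entry, hence in the tail of the chain.
    select-surjective : ∀ {n} {βs : Vec AffineCoroot n} → Linkedᵛ _<ᴵ_ βs → ∀ {L} →
      AllPairs _<ᴵ_ L → All (_∈ βs) L → ∃[ A ] select βs A ≡ L
    select-surjective {βs = []} _ [] [] = [] , refl
    select-surjective {βs = []} _ (_ ∷ _) (() ∷ _)
    select-surjective {βs = β ∷ βs} lk [] []
      with A , eq ← select-surjective (Linkedᵛ.tail lk) [] [] = false ∷ A , eq
    select-surjective {βs = β ∷ βs} lk (β<L ∷ L<) (here refl ∷ L∈)
      with A , eq ← select-surjective (Linkedᵛ.tail lk) L<
             (All.zipWith (λ (β<l , l∈) → ∈-tail β<l l∈) (β<L , L∈))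
      = true ∷ A , cong (β ∷_) eq
    select-surjective {βs = β ∷ βs} lk {b ∷ L} (b<L ∷ L<) (there b∈ ∷ L∈)
      with A , eq ← select-surjective (Linkedᵛ.tail lk) (b<L ∷ L<)
             (b∈ ∷ All.zipWith (λ {l} (b<l , l∈) → ∈-tail (<ᴵ-trans {β} {b} {l} (<ᴵ-head lk b∈) b<l) l∈)
                     (b<L , L∈))
      = false ∷ A , eq

    -- From the end conditions to the image.

    end-target : ∀ A → end A ≡ target w (chosen A)
    end-target A = cong (foldl _·s_ w) (List.take-all _ (labels A) ≤-refl)

    reverse-x : ∀ A → Vec.toList (Triple.x (Ξ A)) ≡ reverse (map (u A ∘ mᶜ A) (cs A ++ [ 1ℚ ]))
    reverse-x A = begin
      Vec.toList (Vec.reverse (Vec.map f c+))   ≡⟨ Vec.toList-reverse (Vec.map f c+) ⟩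
      reverse (Vec.toList (Vec.map f c+))       ≡⟨ cong reverse (Vec.toList-map f c+) ⟩
      reverse (map f (Vec.toList c+))           ≡⟨ cong (reverse ∘ map f) (toList-fromList-∷ʳ (cs A) 1ℚ) ⟩
      reverse (map f (cs A ++ [ 1ℚ ]))          ∎
      where
      open ≡-Reasoning
      f = u A ∘ mᶜ A
      c+ = Vec.fromList (cs A) Vec.∷ʳ 1ℚ

    reverse-y : ∀ A → Vec.toList (Triple.y (Ξ A)) ≡
      reverse (consecutive (λ q q′ → u A (nᶜ A q q′)) (cs A) 1ℚ)
    reverse-y A = trans (Vec.toList-reverse (Vec.tabulate _))
      (cong reverse (tabulate-consecutive (λ q q′ → u A (nᶜ A q q′)) (cs A) 1ℚ))

    -- The outer values c_0 = 0 and c_t = 1 are exchanged by `complement`, by evaluation; only the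
    -- interior ones stay symbolic.
    reverse-σ : ∀ A → Vec.toList (Triple.σ (Ξ A)) ≡
      reverse (1ℚ ∷ map complement (cs A) ++ [ 0ℚ ])
    reverse-σ A = begin
      Vec.toList (Vec.reverse (Vec.map f (c A)))   ≡⟨ Vec.toList-reverse (Vec.map f (c A)) ⟩
      reverse (Vec.toList (Vec.map f (c A)))       ≡⟨ cong reverse (Vec.toList-map f (c A)) ⟩
      reverse (map f (0ℚ ∷ Vec.toList (Vec.fromList (cs A) Vec.∷ʳ 1ℚ)))
        ≡⟨ cong (λ qs → reverse (map f (0ℚ ∷ qs))) (toList-fromList-∷ʳ (cs A) 1ℚ) ⟩
      reverse (1ℚ ∷ map f (cs A ++ [ 1ℚ ]))
        ≡⟨ cong (λ qs → reverse (1ℚ ∷ qs)) (List.map-++ f (cs A) [ 1ℚ ]) ⟩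
      reverse (1ℚ ∷ map f (cs A) ++ [ 0ℚ ])        ∎
      where
      open ≡-Reasoning
      f = complement

    end-conditions⇒image : ∀ η v → IsIQLS η → EndConditions (η , v) → imΞ̃ (η , v)
    end-conditions⇒image (triple m x y (.0ℚ ∷ σ)) v
      record { x-distinct = x≢ ; σ-first = refl ; σ-last = σ-last ; σ-increase = 0<σ ∷ σ<
             ; x⟹y = x⟹y ; y⟹x = y⟹x } (w⟹κ , ι⟹v)
      -- Taking σ = 0 here and σ = 1 on the next line produces the segments with `d` = 1 and `d` =
      -- 0.
      with L₁ , ι⟶v ← ⟹⇒segment Sign.- 0ℚ (⟹-at-0 Sign.- ι⟹v) (ℚ.positive⁻¹ 1ℚ , ℚ.≤-refl)
      with L₀ , w⟶κ ← ⟹⇒segment Sign.+ 1ℚ w⟹κ (ℚ.≤-refl , ℚ.positive⁻¹ 1ℚ)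
      with xs , L , bs , xs-eq ← prepend-blocks x y σ x≢ σ< σ-last 0<σ [] x⟹y y⟹x (last ι⟶v)
      with A , eq ← select-surjective increasing
             -- All of `L₀` has `d` = 0, while every later value of `d` is positive.
             (sorted-++ (Segment.sorted w⟶κ) (blocks-sorted bs)
               (at-d (Segment.at w⟶κ))
               (All.map (ℚ.<-≤-trans (blocks-0<next bs)) (blocks-d≥ bs)))
             (All.map (λ {β} → Equivalence.from (enumerates β))
               (All.++⁺ (All.map (λ (_ , _ , inv) → inv) (Segment.at w⟶κ)) (blocks-inv bs)))
      = A , path , cong₂ _,_ Ξ≡ end≡
      where
      path-v : Path w (labels A) v
      path-v = subst (λ L → Path w (labels⁺ L) v) (sym eq)
        (labels-++ L₀ (Segment.path w⟶κ) (blocks-path bs))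
      end≡ : end A ≡ v
      end≡ = trans (end-target A) (path-target path-v)
      path : 𝒜 A
      path = subst (Path w (labels A)) (sym end≡) path-v
      C = reverse (map complement (Vec.toList (Vec.init σ)))
      -- The segment `L₀` has `d` = 0, which is not an interior value, so only the blocks
      -- contribute.
      cs≡ : cs A ≡ C
      cs≡ = begin
        values (chosen A)   ≡⟨ cong values eq ⟩
        values (L₀ ++ L)    ≡⟨ cong (deduplicate ℚ._≟_ ∘ filter interior?) (List.map-++ d L₀ L) ⟩
        deduplicate ℚ._≟_ (filter interior? (map d L₀ ++ map d L))
          ≡⟨ cong (deduplicate ℚ._≟_) (List.filter-++ interior? (map d L₀) (map d L)) ⟩
        deduplicate ℚ._≟_ (filter interior? (map d L₀) ++ filter interior? (map d L))
          ≡⟨ cong (λ qs → deduplicate ℚ._≟_ (qs ++ filter interior? (map d L)))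
               (List.filter-none interior?
                 (All.map⁺ (All.map (λ e (0<d , _) → ℚ.<-irrefl (sym e) 0<d) (at-d (Segment.at w⟶κ))))) ⟩
        values L            ≡⟨ blocks-values bs ⟩
        C                   ∎
        where open ≡-Reasoning
      u≡ = blocks-u A L₀ bs eq (segment-target w⟶κ)
        (All.map (λ e → subst (ℚ._< next C) (sym e) (blocks-0<next bs)) (at-d (Segment.at w⟶κ)))
      Ξ≡ : Ξ A ≡ triple m x y (0ℚ ∷ σ)
      Ξ≡ = triple-≡ x≡ y≡ σ≡
        where
        open ≡-Reasoning
        x≡ : Vec.toList (Triple.x (Ξ A)) ≡ Vec.toList x
        x≡ = begin
          Vec.toList (Triple.x (Ξ A))                      ≡⟨ reverse-x A ⟩
          reverse (map (u A ∘ mᶜ A) (cs A ++ [ 1ℚ ]))      ≡⟨ cong (λ qs → reverse (map (u A ∘ mᶜ A) (qs ++ [ 1ℚ ]))) cs≡ ⟩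
          reverse (map (u A ∘ mᶜ A) (C ++ [ 1ℚ ]))         ≡⟨ cong reverse (trans (proj₁ u≡) xs-eq) ⟩
          reverse (reverse (Vec.toList x))                 ≡⟨ List.reverse-involutive (Vec.toList x) ⟩
          Vec.toList x                                     ∎
        y≡ : Vec.toList (Triple.y (Ξ A)) ≡ Vec.toList y
        y≡ = begin
          Vec.toList (Triple.y (Ξ A))                                        ≡⟨ reverse-y A ⟩
          reverse (consecutive (λ q q′ → u A (nᶜ A q q′)) (cs A) 1ℚ)
            ≡⟨ cong (λ qs → reverse (consecutive (λ q q′ → u A (nᶜ A q q′)) qs 1ℚ)) cs≡ ⟩
          reverse (consecutive (λ q q′ → u A (nᶜ A q q′)) C 1ℚ)              ≡⟨ cong reverse (proj₂ u≡) ⟩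
          reverse (reverse (Vec.toList y))                                   ≡⟨ List.reverse-involutive (Vec.toList y) ⟩
          Vec.toList y                                                       ∎
        S = Vec.toList (Vec.init σ)
        -- Reading σ_i = 1 - c_{t-i} back from c = 1 - σ uses that `complement` is an involution.
        co-C : map complement C ≡ reverse S
        co-C = begin
          map complement (reverse (map complement S))   ≡⟨ List.reverse-map complement (map complement S) ⟩
          reverse (map complement (map complement S))   ≡⟨ cong reverse (trans (sym (List.map-∘ S)) (trans (List.map-cong 1-[1-p] S) (List.map-id S))) ⟩
          reverse S                     ∎
        σ≡ : Vec.toList (Triple.σ (Ξ A)) ≡ 0ℚ ∷ Vec.toList σ
        σ≡ = begin
          Vec.toList (Triple.σ (Ξ A))                      ≡⟨ reverse-σ A ⟩
          reverse (1ℚ ∷ map complement (cs A) ++ [ 0ℚ ])           ≡⟨ cong (λ qs → reverse (1ℚ ∷ qs ++ [ 0ℚ ])) (trans (cong (map complement) cs≡) co-C) ⟩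
          reverse (1ℚ ∷ reverse S ++ [ 0ℚ ])               ≡⟨ List.unfold-reverse 1ℚ (reverse S ++ [ 0ℚ ]) ⟩
          reverse (reverse S ++ [ 0ℚ ]) ++ [ 1ℚ ]          ≡⟨ cong (_++ [ 1ℚ ]) (List.reverse-++ (reverse S) [ 0ℚ ]) ⟩
          0ℚ ∷ reverse (reverse S) ++ [ 1ℚ ]               ≡⟨ cong₂ (λ qs q → 0ℚ ∷ qs ++ [ q ]) (List.reverse-involutive S) (sym σ-last) ⟩
          0ℚ ∷ S ++ [ Vec.last σ ]                         ≡⟨ cong (0ℚ ∷_) (toList-init-last σ) ⟨
          0ℚ ∷ Vec.toList σ                                ∎

    -- From an admissible subset to the end conditions.

    chosen-inv : ∀ A → All Inv (chosen A)
    chosen-inv A = All.map (λ {β} → Equivalence.to (enumerates β)) (select-∈ βs A)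

    chosen-d≤ : ∀ A → AllPairs (λ β β′ → d β ℚ.≤ d β′) (chosen A)
    chosen-d≤ A = AllPairs.map (λ {β} {β′} → <ᴵ⇒d≤ {β} {β′}) (select-sorted increasing A)

    next≤d : ∀ A {β} → β ∈ˡ chosen A → 0ℚ ℚ.< d β → d β ℚ.< 1ℚ → next (cs A) ℚ.≤ d β
    next≤d A β∈ 0<d d<1 = headOr-≤
      (AllPairs.filter⁺ interior? (AllPairs.map⁺ (chosen-d≤ A)))
      (∈-filter⁺ interior? (∈-map⁺ d β∈) (0<d , d<1))

    next≤1 : ∀ A → next (cs A) ℚ.≤ 1ℚ
    next≤1 A = go (All.deduplicate⁺ ℚ._≟_ (All.all-filter interior? (map d (chosen A))))
      where
      go : ∀ {qs} → All (λ q → 0ℚ ℚ.< q × q ℚ.< 1ℚ) qs → next qs ℚ.≤ 1ℚ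
      go []              = ℚ.≤-refl
      go ((_ , q<1) ∷ _) = ℚ.<⇒≤ q<1

    -- The x_i run opposite to the c_a, so the final direction is read at c_1, which is c_t = 1 when
    -- no interior value occurs; the initial direction is read at c_t.
    κ-Ξ : ∀ A → κ (Ξ A) ≡ u A (mᶜ A (next (cs A)))
    κ-Ξ A = trans (Vec.last-reverse (Vec.map (u A ∘ mᶜ A) (Vec.tail (c A)))) (go (cs A))
      where
      go : ∀ qs → Vec.head (Vec.map (u A ∘ mᶜ A) (Vec.fromList qs Vec.∷ʳ 1ℚ)) ≡ u A (mᶜ A (next qs))
      go []      = refl
      go (_ ∷ _) = refl

    ι-Ξ : ∀ A → ι (Ξ A) ≡ u A (mᶜ A 1ℚ)
    ι-Ξ A = begin
      Vec.head (Vec.reverse v)                  ≡⟨ Vec.last-reverse (Vec.reverse v) ⟨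
      Vec.last (Vec.reverse (Vec.reverse v))    ≡⟨ cong Vec.last (Vec.reverse-involutive v) ⟩
      Vec.last v                                ≡⟨ cong Vec.last (Vec.map-∷ʳ f 1ℚ (Vec.fromList (cs A))) ⟩
      Vec.last (Vec.map f (Vec.fromList (cs A)) Vec.∷ʳ f 1ℚ)   ≡⟨ Vec.last-∷ʳ (f 1ℚ) (Vec.map f (Vec.fromList (cs A))) ⟩
      f 1ℚ                                      ∎
      where
      open ≡-Reasoning
      f = u A ∘ mᶜ A
      v = Vec.map f (Vec.fromList (cs A) Vec.∷ʳ 1ℚ)

    module _ (A : Subset r) (q : ℚ) where

      split-at : ∃[ L ] ∃[ L′ ] chosen A ≡ L ++ L′ ×
        All (λ β → d β ℚ.< q) L × All (λ β → q ℚ.≤ d β) L′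
      split-at = splitAt-< d q (chosen A) (chosen-d≤ A)

      before after : List AffineCoroot
      before = proj₁ split-at
      after  = proj₁ (proj₂ split-at)

      chosen≡ : chosen A ≡ before ++ after
      chosen≡ = proj₁ (proj₂ (proj₂ split-at))

      before< : All (λ β → d β ℚ.< q) before
      before< = proj₁ (proj₂ (proj₂ (proj₂ split-at)))

      after≥ : All (λ β → q ℚ.≤ d β) after
      after≥ = proj₂ (proj₂ (proj₂ (proj₂ split-at)))

      u-before : u A (mᶜ A q) ≡ target w before
      u-before = trans (cong (u A) (mᶜ-length A q chosen≡ before< after≥))
                       (u-target A before chosen≡)

      split-path : 𝒜 A →
        Path w (labels⁺ before) (u A (mᶜ A q)) × Path (u A (mᶜ A q)) (labels⁺ after) (end A)
      split-path path rewrite u-before = path-++⁻ (labels⁺ before)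
        (subst (λ as → Path w as (end A))
          (trans (cong labels⁺ chosen≡) (List.map-++ label before after)) path)

      split-sorted : AllPairs _<ᴵ_ before × AllPairs _<ᴵ_ after
      split-sorted = AllPairs-++⁻ before
        (subst (AllPairs _<ᴵ_) chosen≡ (select-sorted increasing A))

      split-inv : All Inv before × All Inv after
      split-inv = All.++⁻ before (subst (All Inv) chosen≡ (chosen-inv A))

    -- Cutting the chosen list at c_1 leaves the part with `d` = 0 in front, and cutting it at 1
    -- leaves the part with `d` = 1 behind. `Range` excludes negative roots at 0 and positive roots
    -- at 1, so both parts are segments.
    𝒜⇒end-conditions : ∀ A → 𝒜 A → EndConditions (Ξ̃ A)
    𝒜⇒end-conditions A path =
      subst (w ⟹[ Sign.+ ]_) (sym (κ-Ξ A)) (segment⇒⟹ (segment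
        (proj₁ (split-path A q path)) at-0 (proj₁ (split-sorted A q)))) ,
      subst (_⟹[ Sign.- ] end A) (sym (ι-Ξ A)) (segment⇒⟹ (segment
        (proj₂ (split-path A 1ℚ path)) at-1 (proj₂ (split-sorted A 1ℚ))))
      where
      q = next (cs A)
      before-at-0 : ∀ {β} → β ∈ˡ chosen A → d β ℚ.< q → Inv β → At Sign.+ 0ℚ β
      before-at-0 {β} β∈ d<q inv = go (sign β) refl (inv⇒range β inv)
        where
        -- A positive value below `q` would be interior, yet smaller than the least interior value.
        d≮0 : ¬ (0ℚ ℚ.< d β)
        d≮0 0<d = ℚ.<-irrefl refl
          (ℚ.<-≤-trans d<q (next≤d A β∈ 0<d (ℚ.<-≤-trans d<q (next≤1 A))))
        go : ∀ s → sign β ≡ s → Range s (d β) → At Sign.+ 0ℚ β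
        go Sign.+ s≡ (0≤d , _) = s≡ , ℚ.≤-antisym (ℚ.≮⇒≥ d≮0) 0≤d , inv
        go Sign.- s≡ (0<d , _) = contradiction 0<d d≮0
      at-0 : All (At Sign.+ 0ℚ) (before A q)
      at-0 = All.zipWith (λ (f , d<q , inv) → f d<q inv)
        ( All.++⁻ˡ (before A q) (subst (All _) (chosen≡ A q) (All.tabulate before-at-0))
        , All.zip (before< A q , proj₁ (split-inv A q)))
      after-at-1 : ∀ {β} → 1ℚ ℚ.≤ d β → Inv β → At Sign.- 1ℚ β
      after-at-1 {β} 1≤d inv = go (sign β) refl (inv⇒range β inv)
        where
        go : ∀ s → sign β ≡ s → Range s (d β) → At Sign.- 1ℚ β
        go Sign.+ s≡ (_ , d<1) = contradiction (ℚ.<-≤-trans d<1 1≤d) (ℚ.<-irrefl refl)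
        go Sign.- s≡ (_ , d≤1) = s≡ , ℚ.≤-antisym d≤1 1≤d , inv
      at-1 : All (At Sign.- 1ℚ) (after A 1ℚ)
      at-1 = All.zipWith (λ (1≤d , inv) → after-at-1 1≤d inv)
        (after≥ A 1ℚ , proj₂ (split-inv A 1ℚ))

-- The map `Ξ` takes values in `Triple`, so the equality of sets is stated for triples satisfying
-- `IsIQLS`. The second component gives the end conditions for every admissible subset, including
-- those for which two consecutive y_i coincide.
theorem5p4 : (R : RootSystem) (lam : RootSystem.P R) (_◁_ : Rel (RootSystem.Δ⁺ R) 0ℓ) →
    Shape.IsRO R lam _◁_ →
    (Γ : Shape.SuitableChain R lam _◁_) (w : WeylGroup.W R) →
    (∀ η v → Shape.IsIQLS R lam _◁_ η →
    Shape.Forgetful.imΞ̃ R lam _◁_ Γ w (η , v) ⇔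
    Shape.Forgetful.EndConditions R lam _◁_ Γ w (η , v))
    × (∀ A → Shape.Forgetful.𝒜 R lam _◁_ Γ w A →
    Shape.Forgetful.EndConditions R lam _◁_ Γ w (Shape.Forgetful.Ξ̃ R lam _◁_ Γ w A))
theorem5p4 R lam _◁_ ro Γ w =
  (λ η v iqls → mk⇔ (λ { (A , path , refl) → 𝒜⇒end-conditions Γ w A path })
                    (end-conditions⇒image Γ w η v iqls)) ,
  𝒜⇒end-conditions Γ w
  where open Chains R lam _◁_ (Shape.IsRO.isStrictTotalOrder ro)
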